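{- For every finite set $Y$ of names and all $s,k\in\mathbb N$, the quasi-order $(\mathrm{Depth}^Y_{s,k},\sqsubseteq)$ is a well-quasi-order, i.e. every infinite sequence $P_0,P_1,\dots$ of elements of $\mathrm{Depth}^Y_{s,k}$ has indices $i<j$ with $P_i\sqsubseteq P_j$.
   Context: Fix an effective intruder model $(\Sigma,\vdash)$: messages are terms over a countably infinite set of names and a finite constructor signature $\Sigma$; $\vdash$ is a decidable relation between finite sets of messages and messages satisfying: $\{M\}\vdash M$; $\Gamma\subseteq\Gamma'$, $\Gamma\vdash M$ imply $\Gamma'\vdash M$; $\Gamma\vdash M$ and $\Gamma\cup\{M\}\vdash N$ imply $\Gamma\vdash N$; $\{M_1,\dots,M_n\}\vdash f(M_1,\dots,M_n)$ for each constructor $f$ of arity $n$; $\Gamma\theta\vdash M\theta$ iff $\Gamma\vdash M$ for each injective renaming $\theta$ of the names of $\Gamma$ into names; $\Gamma\cup\{a\}\vdash M$ with $a$ a name not in $\Gamma,M$ implies $\Gamma\vdash M$. $\Gamma_1\preceq\Gamma_2$ iff every $M$ with $\Gamma_1\vdash M$ has $\Gamma_2\vdash M$; $\Gamma_1\simeq\Gamma_2$ iff both directions. $\mathrm{size}(a)=1$, $\mathrm{size}(f(M_1,\dots,M_n))=1+\max_i\mathrm{size}(M_i)$. Processes (over a finite set of process identifiers $\mathsf Q$ with arities): $P::=0\mid\nu x.P\mid P\parallel P\mid\langle M\rangle\mid\mathsf Q[M_1,\dots,M_n]$ ($\nu x$ binds $x$; $\langle M\rangle$: $M$ known to intruder);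 $\langle\Gamma\rangle$ = parallel composition of $\langle M\rangle$, $M\in\Gamma$. $\equiv$: smallest congruence containing $\alpha$-equivalence, with $\parallel$ associative-commutative with neutral $0$, $\nu a.0\equiv0$, $\nu a.\nu b.P\equiv\nu b.\nu a.P$, $P\parallel\nu a.Q\equiv\nu a.(P\parallel Q)$ if $a$ not free in $P$. Every process is $\equiv$ to a standard form $\nu\vec x.(\langle\Gamma\rangle\parallel\mathsf Q_1[\vec N_1]\parallel\dots\parallel\mathsf Q_m[\vec N_m])$; $\mathrm{msg}(P)$ is the set of messages in $\Gamma$ and the $\vec N_i$. $\cong$: smallest congruence containing $\equiv$ with $\langle\Gamma_1\rangle\cong\langle\Gamma_2\rangle$ when $\Gamma_1\simeq\Gamma_2$. $P_1\sqsubseteq P_2$ iff $P_1\equiv\nu\vec x.(\langle\Gamma_1\rangle\parallel Q)$, $P_2\equiv\nu\vec x.\nu\vec y.(\langle\Gamma_2\rangle\parallel Q\parallel Q')$ with $\Gamma_1\preceq\Gamma_2$. $\mathrm{nest}$: $0$ on $0,\langle M\rangle,\mathsf Q[\vec M]$, $\mathrm{nest}(\nu x.P)=1+\mathrm{nest}(P)$, $\mathrm{nest}(P\parallel Q)=\max$. $\mathrm{Size}_s$: processes with all messages of $\mathrm{msg}(P)$ of size $\le s$. $\mathrm{Depth}^Y_{s,k}$: the $P\in\mathrm{Size}_s$ with free names in $Y$ such that some $Q\in\mathrm{Size}_s$ has $Q\cong P$ and $\mathrm{nest}(Q)\le k$. -}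

module Defs where

open import Data.Nat using (ℕ; zero; suc; _≤_; _<_; _⊔_; _≡ᵇ_)
open import Data.Bool using (if_then_else_)
open import Data.Fin using (Fin)
open import Data.Vec using (Vec; []; _∷_; toList)
open import Data.List using (List; []; _∷_; map)
open import Data.List.Membership.Propositional using (_∈_)
open import Data.List.Relation.Unary.Any using (Any)
open import Data.List.Relation.Binary.Subset.Propositional using (_⊆_)
open import Data.Product using (_×_; ∃-syntax)
open import Relation.Nullary using (¬_; Dec)
open import Relation.Binary.PropositionalEquality using (_≡_; _≢_)
open import Function.Definitions using (Injective)

-- Names: a countably infinite set, represented by ℕ.
Name : Set
Name = ℕ

-- A finite signature: finitely many symbols, each with an arity.
-- Used both for the message constructors Σ and for the process identifiers 𝖰.
record Signature : Set where
  field
    nsym  : ℕ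
    arity : Fin nsym → ℕ
open Signature public

data Msg (S : Signature) : Set where
  name : Name → Msg S
  app  : (f : Fin (nsym S)) → Vec (Msg S) (arity S f) → Msg S

module _ {S : Signature} where

  mutual
    size : Msg S → ℕ
    size (name a)   = 1
    size (app f Ms) = suc (sizes Ms)

    sizes : ∀ {n} → Vec (Msg S) n → ℕ
    sizes []       = 0
    sizes (M ∷ Ms) = size M ⊔ sizes Ms

  mutual
    rename : (Name → Name) → Msg S → Msg S
    rename θ (name a)   = name (θ a)
    rename θ (app f Ms) = app f (renames θ Ms)

    renames : ∀ {n} → (Name → Name) → Vec (Msg S) n → Vec (Msg S) n
    renames θ []       = []
    renames θ (M ∷ Ms) = rename θ M ∷ renames θ Ms

  mutual
    data _∈nm_ (a : Name) : Msg S → Set where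
      nm-name : a ∈nm name a
      nm-app  : ∀ {f Ms} → a ∈nms Ms → a ∈nm app f Ms

    data _∈nms_ (a : Name) : ∀ {n} → Vec (Msg S) n → Set where
      nms-here  : ∀ {n M} {Ms : Vec (Msg S) n} → a ∈nm M → a ∈nms (M ∷ Ms)
      nms-there : ∀ {n M} {Ms : Vec (Msg S) n} → a ∈nms Ms → a ∈nms (M ∷ Ms)

  _∈names_ : Name → List (Msg S) → Set
  a ∈names Γ = Any (a ∈nm_) Γ

-- Effective intruder models (finite sets of messages are lists;
-- Γ ∪ {M} is M ∷ Γ)

record IntruderModel (S : Signature) : Set₁ where
  field
    _⊢_      : List (Msg S) → Msg S → Set
    ⊢-dec    : ∀ Γ M → Dec (Γ ⊢ M)
    ⊢-ax     : ∀ M → (M ∷ []) ⊢ M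
    ⊢-mono   : ∀ {Γ Γ' M} → Γ ⊆ Γ' → Γ ⊢ M → Γ' ⊢ M
    ⊢-cut    : ∀ {Γ M N} → Γ ⊢ M → (M ∷ Γ) ⊢ N → Γ ⊢ N
    ⊢-cons   : ∀ (f : Fin (nsym S)) (Ms : Vec (Msg S) (arity S f)) →
               toList Ms ⊢ app f Ms
    ⊢-ren⇒   : ∀ (θ : Name → Name) → Injective _≡_ _≡_ θ → ∀ Γ M →
               Γ ⊢ M → map (rename θ) Γ ⊢ rename θ M
    ⊢-ren⇐   : ∀ (θ : Name → Name) → Injective _≡_ _≡_ θ → ∀ Γ M →
               map (rename θ) Γ ⊢ rename θ M → Γ ⊢ M
    ⊢-fresh  : ∀ {Γ M a} → ¬ (a ∈names Γ) → ¬ (a ∈nm M) →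
               (name a ∷ Γ) ⊢ M → Γ ⊢ M

module _ {S : Signature} (I : IntruderModel S) where
  open IntruderModel I

  _⪯_ : List (Msg S) → List (Msg S) → Set
  Γ₁ ⪯ Γ₂ = ∀ M → Γ₁ ⊢ M → Γ₂ ⊢ M

  _≃_ : List (Msg S) → List (Msg S) → Set
  Γ₁ ≃ Γ₂ = (Γ₁ ⪯ Γ₂) × (Γ₂ ⪯ Γ₁)

-- Processes (S = message signature Σ, QS = process identifiers 𝖰)

data Proc (S QS : Signature) : Set where
  𝟘    : Proc S QS
  ν    : Name → Proc S QS → Proc S QS
  _∥_  : Proc S QS → Proc S QS → Proc S QS
  ⟪_⟫  : Msg S → Proc S QS
  call : (q : Fin (nsym QS)) → Vec (Msg S) (arity QS q) → Proc S QS

module _ {S QS : Signature} where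

  know : List (Msg S) → Proc S QS
  know []      = 𝟘
  know (M ∷ Γ) = ⟪ M ⟫ ∥ know Γ

  νs : List Name → Proc S QS → Proc S QS
  νs []       P = P
  νs (x ∷ xs) P = ν x (νs xs P)

  swapName : Name → Name → Name → Name
  swapName x y a = if a ≡ᵇ x then y else (if a ≡ᵇ y then x else a)

  swapP : Name → Name → Proc S QS → Proc S QS
  swapP x y 𝟘          = 𝟘
  swapP x y (ν z P)    = ν (swapName x y z) (swapP x y P)
  swapP x y (P ∥ Q)    = swapP x y P ∥ swapP x y Q
  swapP x y ⟪ M ⟫      = ⟪ rename (swapName x y) M ⟫
  swapP x y (call q Ms) = call q (renames (swapName x y) Ms)

  data _∈fn_ (a : Name) : Proc S QS → Set where
    fn-ν    : ∀ {x P} → a ≢ x → a ∈fn P → a ∈fn ν x P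
    fn-∥ˡ   : ∀ {P Q} → a ∈fn P → a ∈fn (P ∥ Q)
    fn-∥ʳ   : ∀ {P Q} → a ∈fn Q → a ∈fn (P ∥ Q)
    fn-msg  : ∀ {M} → a ∈nm M → a ∈fn ⟪ M ⟫
    fn-call : ∀ {q Ms} → a ∈nms Ms → a ∈fn call q Ms

  data _∈msgV_ (M : Msg S) : ∀ {n} → Vec (Msg S) n → Set where
    mv-here  : ∀ {n} {Ms : Vec (Msg S) n} → M ∈msgV (M ∷ Ms)
    mv-there : ∀ {n N} {Ms : Vec (Msg S) n} → M ∈msgV Ms → M ∈msgV (N ∷ Ms)

  data _∈msg_ (M : Msg S) : Proc S QS → Set where
    msg-ν    : ∀ {x P} → M ∈msg P → M ∈msg ν x P
    msg-∥ˡ   : ∀ {P Q} → M ∈msg P → M ∈msg (P ∥ Q)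
    msg-∥ʳ   : ∀ {P Q} → M ∈msg Q → M ∈msg (P ∥ Q)
    msg-out  : M ∈msg ⟪ M ⟫
    msg-call : ∀ {q Ms} → M ∈msgV Ms → M ∈msg call q Ms

  data _≡ₚ_ : Proc S QS → Proc S QS → Set where
    ≡-refl   : ∀ {P} → P ≡ₚ P
    ≡-sym    : ∀ {P Q} → P ≡ₚ Q → Q ≡ₚ P
    ≡-trans  : ∀ {P Q R} → P ≡ₚ Q → Q ≡ₚ R → P ≡ₚ R
    ≡-ν      : ∀ {x P Q} → P ≡ₚ Q → ν x P ≡ₚ ν x Q
    ≡-∥      : ∀ {P P' Q Q'} → P ≡ₚ P' → Q ≡ₚ Q' → (P ∥ Q) ≡ₚ (P' ∥ Q')
    ≡-α      : ∀ {x y P} → ¬ (y ∈fn ν x P) → ν x P ≡ₚ ν y (swapP x y P)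
    ≡-assoc  : ∀ {P Q R} → ((P ∥ Q) ∥ R) ≡ₚ (P ∥ (Q ∥ R))
    ≡-comm   : ∀ {P Q} → (P ∥ Q) ≡ₚ (Q ∥ P)
    ≡-unit   : ∀ {P} → (P ∥ 𝟘) ≡ₚ P
    ≡-ν𝟘     : ∀ {a} → ν a 𝟘 ≡ₚ 𝟘
    ≡-νν     : ∀ {a b P} → ν a (ν b P) ≡ₚ ν b (ν a P)
    ≡-scope  : ∀ {a P Q} → ¬ (a ∈fn P) → (P ∥ ν a Q) ≡ₚ ν a (P ∥ Q)

  nest : Proc S QS → ℕ
  nest 𝟘          = 0
  nest (ν x P)    = suc (nest P)
  nest (P ∥ Q)    = nest P ⊔ nest Q
  nest ⟪ M ⟫      = 0
  nest (call q Ms) = 0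

  InSize : ℕ → Proc S QS → Set
  InSize s P = ∀ M → M ∈msg P → size M ≤ s

module _ {S QS : Signature} (I : IntruderModel S) where

  data _≅_ : Proc S QS → Proc S QS → Set where
    ≅-struct : ∀ {P Q} → P ≡ₚ Q → P ≅ Q
    ≅-know   : ∀ {Γ₁ Γ₂} → _≃_ I Γ₁ Γ₂ → know Γ₁ ≅ know Γ₂
    ≅-sym    : ∀ {P Q} → P ≅ Q → Q ≅ P
    ≅-trans  : ∀ {P Q R} → P ≅ Q → Q ≅ R → P ≅ R
    ≅-ν      : ∀ {x P Q} → P ≅ Q → ν x P ≅ ν x Q
    ≅-∥      : ∀ {P P' Q Q'} → P ≅ P' → Q ≅ Q' → (P ∥ Q) ≅ (P' ∥ Q')

  _⊑_ : Proc S QS → Proc S QS → Set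
  P₁ ⊑ P₂ = ∃[ xs ] ∃[ ys ] ∃[ Γ₁ ] ∃[ Γ₂ ] ∃[ Q ] ∃[ Q' ]
              (P₁ ≡ₚ νs xs (know Γ₁ ∥ Q)) ×
              (P₂ ≡ₚ νs xs (νs ys ((know Γ₂ ∥ Q) ∥ Q'))) ×
              _⪯_ I Γ₁ Γ₂

  Depth : List Name → ℕ → ℕ → Proc S QS → Set
  Depth Y s k P =
    InSize s P ×
    (∀ a → a ∈fn P → a ∈ Y) ×
    (∃[ Q ] InSize s Q × (Q ≅ P) × nest Q ≤ k)

{-# OPTIONS --safe #-}

-- Idea.  A process P is interpreted by its standard form ⟦ P ⟧, the messages known to the
-- intruder and the process calls, with free names coded by even and bound names by odd
-- numbers.  T ≲ U holds if an injective renaming of bound names makes the messages of T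
-- derivable from those of U and the calls of T a submultiset of those of U.  Congruent
-- processes have ≲-equivalent standard forms, and ⟦ P ⟧ ≲ ⟦ P′ ⟧ implies P ⊑ P′.
--
-- A witness Q of Depth is, after renaming the binder at nesting level l to b + l, a forest of
-- height at most k + 1 with finitely many labels, and bounded forests are almost full by
-- iterating Higman's lemma.  The witness may contain free names that P does not have
-- (when Γ₁ ≃ Γ₂, the names of Γ₁ and Γ₂ can differ), without any bound on them.  They occur
-- in known messages only, and since P derives these messages without having the names, each
-- message can be renamed separately to use only finitely many of them.
module Submission where

open import Defs
open import Level using (0ℓ)
open import Data.Bool using (true; false; if_then_else_)
open import Data.Empty using (⊥; ⊥-elim)
open import Data.Fin using (Fin; toℕ)
import Data.Fin.Properties as Finₚ
open import Data.List using (List; []; _∷_; _++_; map; length; upTo; allFin; concatMap; cartesianProductWith; lookup)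
open import Data.List.Extrema.Nat using (max; xs≤max)
open import Data.List.Membership.Propositional using (_∈_; lose)
open import Data.List.Membership.Propositional.Properties using (∈-map⁺; ∈-map⁻; ∈-++⁺ˡ; ∈-++⁺ʳ; ∈-++⁻; ∈-concatMap⁺; ∈-concat⁺′; ∈-cartesianProductWith⁺; ∈-allFin; ∈-upTo⁺)
open import Data.List.Properties using (map-cong-local; map-∘; map-++; length-++; ++-assoc; ++-identityʳ)
open import Data.List.Relation.Binary.Permutation.Propositional using (_↭_; ↭-refl; ↭-sym; ↭-trans; ↭-reflexive)
import Data.List.Relation.Binary.Permutation.Propositional as Perm
import Data.List.Relation.Binary.Permutation.Propositional.Properties as ↭ₚ
open import Data.List.Relation.Binary.Pointwise using (Pointwise; []; _∷_)
import Data.List.Relation.Binary.Pointwise as Pointwise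
open import Data.List.Relation.Binary.Sublist.Heterogeneous using (Sublist; []; _∷_; _∷ʳ_; minimum)
open import Data.List.Relation.Binary.Sublist.Heterogeneous.Properties using (++⁺; ++ˡ; sublist?)
open import Data.List.Relation.Unary.All using (All; []; _∷_)
import Data.List.Relation.Unary.All as All
open import Data.List.Relation.Unary.Any using (Any; here; there)
import Data.List.Relation.Unary.Any as Any
import Data.List.Relation.Unary.Any.Properties as Anyₚ
open import Data.Nat using (ℕ; zero; suc; 2+; _+_; _*_; _∸_; _⊔_; _≤_; _<_; _≡ᵇ_; _<?_; _≟_; z≤n; s≤s)
open import Data.Nat.Properties
open import Data.Product using (_×_; _,_; proj₁; proj₂; ∃-syntax; Σ-syntax)
open import Data.Sum using (_⊎_; inj₁; inj₂; [_,_]′; map₁; assocʳ; assocˡ; swap)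
import Data.Sum as Sum
open import Data.Sum.Properties using (inj₁-injective; inj₂-injective)
open import Data.Unit using (⊤; tt)
open import Data.Vec using (Vec; []; _∷_)
open import Function using (_∘_; id)
open import Function.Definitions using (Injective)
open import Relation.Binary using (Rel; Decidable)
open import Relation.Binary.PropositionalEquality
open import Relation.Nullary using (¬_; Dec; yes; no; contradiction)
open import Relation.Nullary.Decidable using (_⊎-dec_; _×-dec_)
open import Relation.Unary using (Pred)

-- `AlmostFull` is an inductive form of well-quasi-order. Its closure properties are proved without
-- choice or excluded middle, and a proof still computes the good pair.
--
-- The obstacle is that the canonical process built from a witness `Q` need not be `≲`-equivalent to
-- `Q`: different messages are renamed by unrelated injections, so coincidences between surplus
-- names of different messages are lost. What survives is the comparison with a standard form `T`
-- whose free names all lie below `b`. Derivability is invariant under injective renaming and every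
-- renaming used fixes `T`, so the canonical process is below `T` exactly when `Q` is (given that
-- the calls of `Q` have small names too). The chain from `P i` to `P j` is therefore arranged so
-- that both canonical processes are compared with the same target `⟦ P j ⟧`.
--
-- Derivability is assumed invariant only under total injections on names. Hence every finite choice
-- of names below is extended to an injection of all of ℕ.

private
  variable
    X X′ : Set

-- Almost full relations and their closure properties

infixl 5 _↑_
-- Once `x` has been seen, a later `y` above `x` ends the search, whatever follows `y`.
_↑_ : Rel X 0ℓ → X → Rel X 0ℓ
(R ↑ x) y z = R y z ⊎ R x y

-- A proof is a well-founded tree that branches over the next element of a sequence. Induction on
-- this tree takes the place of minimal bad sequences.
data AlmostFull {X : Set} (R : Rel X 0ℓ) : Set₁ where
  now   : (∀ x y → R x y) → AlmostFull R
  later : (∀ x → AlmostFull (R ↑ x)) → AlmostFull R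

private
  variable
    R S W : Rel X 0ℓ

goodPair : AlmostFull R → (f : ℕ → X) → ∃[ i ] ∃[ j ] (i < j) × R (f i) (f j)
goodPair (now r)   f = 0 , 1 , s≤s z≤n , r _ _
goodPair (later g) f with goodPair (g (f 0)) (f ∘ suc)
... | i , j , i<j , inj₁ r = suc i , suc j , s≤s i<j , r
... | i , j , i<j , inj₂ r = 0 , suc i , s≤s z≤n , r

af-mono : (∀ {x y} → R x y → S x y) → AlmostFull R → AlmostFull S
af-mono R⊆S (now r)   = now λ x y → R⊆S (r x y)
af-mono R⊆S (later g) = later λ x → af-mono (Sum.map R⊆S R⊆S) (g x)

af-comap : (f : X′ → X) → AlmostFull R → AlmostFull (λ x y → R (f x) (f y))
af-comap f (now r)   = now λ x y → r (f x) (f y)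
af-comap f (later g) = later λ x → af-comap f (g (f x))

private
  ⊎-zip : {A B C : Set} → C ⊎ A → C ⊎ B → C ⊎ A × B
  ⊎-zip (inj₁ c) _        = inj₁ c
  ⊎-zip (inj₂ _) (inj₁ c) = inj₁ c
  ⊎-zip (inj₂ a) (inj₂ b) = inj₂ (a , b)

  ⊎-swapʳ : {A B C : Set} → (A ⊎ B) ⊎ C → (A ⊎ C) ⊎ B
  ⊎-swapʳ (inj₁ (inj₁ a)) = inj₁ (inj₁ a)
  ⊎-swapʳ (inj₁ (inj₂ b)) = inj₂ b
  ⊎-swapʳ (inj₂ c)        = inj₁ (inj₂ c)

  ⊎-interchange : {A B C D : Set} → ((A ⊎ B) ⊎ C) ⊎ D → (A ⊎ C) ⊎ (B ⊎ D)
  ⊎-interchange (inj₁ (inj₁ (inj₁ a))) = inj₁ (inj₁ a)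
  ⊎-interchange (inj₁ (inj₁ (inj₂ b))) = inj₂ (inj₁ b)
  ⊎-interchange (inj₁ (inj₂ c))        = inj₁ (inj₂ c)
  ⊎-interchange (inj₂ d)               = inj₂ (inj₂ d)

  ⊎-collect : {A B C D : Set} → (A ⊎ C) ⊎ (B ⊎ D) → ((A ⊎ B) ⊎ D) ⊎ C
  ⊎-collect (inj₁ (inj₁ a)) = inj₁ (inj₁ (inj₁ a))
  ⊎-collect (inj₁ (inj₂ c)) = inj₂ c
  ⊎-collect (inj₂ (inj₁ b)) = inj₁ (inj₁ (inj₂ b))
  ⊎-collect (inj₂ (inj₂ d)) = inj₁ (inj₂ d)

-- The intersection theorem is generalised to the arities 0, 1, 2 of the intersected
-- predicates A and B: consuming an element x turns A into A x, of arity one less.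
af-∩₀ : {A B : Set} → AlmostFull R → AlmostFull S →
        (∀ {x y} → R x y → W x y ⊎ A) → (∀ {x y} → S x y → W x y ⊎ B) →
        AlmostFull (λ x y → W x y ⊎ A × B)
af-∩₀ (now r) q f g = af-mono (λ s → ⊎-zip (f (r _ _)) (g s)) q
af-∩₀ {W = W} {A} {B} (later p) q f g = later λ x → af-mono
  [ Sum.map inj₁ inj₁ , inj₁ ∘ inj₂ ]′
  (af-∩₀ {W = W ↑ x} {A} {B} (p x) q
    [ map₁ inj₁ ∘ f , map₁ inj₂ ∘ f ]′ (map₁ inj₁ ∘ g))

af-∩₁ : {A B : Pred X 0ℓ} → AlmostFull R → AlmostFull S →
        (∀ {x y} → R x y → W x y ⊎ A x) → (∀ {x y} → S x y → W x y ⊎ B x) →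
        AlmostFull (λ x y → W x y ⊎ A x × B x)
af-∩₁ (now r)     q       f g = af-mono (λ s → ⊎-zip (f (r _ _)) (g s)) q
af-∩₁ p@(later _) (now s) f g = af-mono (λ r → ⊎-zip (f r) (g (s _ _))) p
af-∩₁ {W = W} {A} {B} p@(later p′) q@(later q′) f g = later λ x → af-mono ⊎-interchange
  (af-∩₀ {W = λ y z → (W ↑ x) y z ⊎ A y × B y} {A x} {B x}
    (af-∩₁ {W = λ y z → (W ↑ x) y z ⊎ A x} (p′ x) q
      (⊎-collect ∘ Sum.map f f) (map₁ (inj₁ ∘ inj₁) ∘ g))
    (af-∩₁ {W = λ y z → (W ↑ x) y z ⊎ B x} p (q′ x)
      (map₁ (inj₁ ∘ inj₁) ∘ f) (⊎-collect ∘ Sum.map g g))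
    ⊎-swapʳ ⊎-swapʳ)

af-∩₂ : {A B : Rel X 0ℓ} → AlmostFull R → AlmostFull S →
        (∀ {x y} → R x y → W x y ⊎ A x y) → (∀ {x y} → S x y → W x y ⊎ B x y) →
        AlmostFull (λ x y → W x y ⊎ A x y × B x y)
af-∩₂ (now r)     q       f g = af-mono (λ s → ⊎-zip (f (r _ _)) (g s)) q
af-∩₂ p@(later _) (now s) f g = af-mono (λ r → ⊎-zip (f r) (g (s _ _))) p
af-∩₂ {W = W} {A} {B} p@(later p′) q@(later q′) f g = later λ x → af-mono ⊎-interchange
  -- Each inner call lets `x` act on one side only and leaves `A x y` or `B x y` behind as an
  -- alternative. Both are unary in `y`, so the intersection of arity one joins them into the
  -- missing pair `A x y × B x y`.
  (af-∩₁ {W = λ y z → (W ↑ x) y z ⊎ A y z × B y z} {A x} {B x}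
    (af-∩₂ {W = λ y z → (W ↑ x) y z ⊎ A x y} (p′ x) q
      (⊎-collect ∘ Sum.map f f) (map₁ (inj₁ ∘ inj₁) ∘ g))
    (af-∩₂ {W = λ y z → (W ↑ x) y z ⊎ B x y} p (q′ x)
      (map₁ (inj₁ ∘ inj₁) ∘ f) (⊎-collect ∘ Sum.map g g))
    ⊎-swapʳ ⊎-swapʳ)

af-∩ : AlmostFull R → AlmostFull S → AlmostFull (λ x y → R x y × S x y)
af-∩ p q = af-mono (λ { (inj₂ c) → c }) (af-∩₂ {W = λ _ _ → ⊥} p q inj₂ inj₂)

-- After `n`, the next number is either at least `n`, which ends the search, or strictly smaller, so
-- that the recursion descends.
af-≤ : AlmostFull _≤_
af-≤ = later below
  where
  below : ∀ n → AlmostFull (_≤_ ↑ n)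
  below zero    = now λ _ _ → inj₂ z≤n
  below (suc n) = later λ m → case-≤ m (n <? m)
    where
    case-≤ : ∀ m → Dec (n < m) → AlmostFull (_≤_ ↑ suc n ↑ m)
    case-≤ m (yes n<m) = now λ _ _ → inj₂ (inj₂ n<m)
    case-≤ m (no n≮m)  = af-mono (Sum.map inj₁ (inj₁ ∘ ≤-trans (≮⇒≥ n≮m))) (below n)

-- The pigeonhole principle as an instance of `af-∩`: `n ∸ toℕ i` reverses the order, and being
-- below in both orders means being equal.
af-Fin-≡ : ∀ {n} → AlmostFull {Fin n} _≡_
af-Fin-≡ {n} = af-mono both
  (af-∩ (af-comap toℕ af-≤) (af-comap (λ i → n ∸ toℕ i) af-≤))
  where
  both : ∀ {i j : Fin n} → toℕ i ≤ toℕ j × n ∸ toℕ i ≤ n ∸ toℕ j → i ≡ j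
  both {i} (i≤j , n∸i≤n∸j) = Finₚ.toℕ-injective (≤-antisym i≤j
    (∸-cancelʳ-≤ (<⇒≤ (Finₚ.toℕ<n _)) n∸i≤n∸j))

-- Higman's lemma, by induction on the proof that R is almost full.  A word that does
-- not contain a ∷ w either has no letter above a, or splits at its first letter above
-- a into a prefix without such letters and a suffix that does not contain w; on words
-- without letters above a, R agrees with R ↑ a.
module _ {X : Set} {R : Rel X 0ℓ} (R? : Decidable R) where

  data FirstAbove (a : X) : List X → Set where
    none  : ∀ {u} → All (¬_ ∘ R a) u → FirstAbove a u
    at : ∀ u {b} t → All (¬_ ∘ R a) u → R a b → FirstAbove a (u ++ b ∷ t)

  firstAbove : ∀ a v → FirstAbove a v
  firstAbove a []      = none []
  firstAbove a (b ∷ v) with R? a b | firstAbove a v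
  ... | yes r | _             = at [] v [] r
  ... | no ¬r | none n        = none (¬r ∷ n)
  ... | no ¬r | at u t n r = at (b ∷ u) t (¬r ∷ n) r

  private
    parts : ∀ {a v} → FirstAbove a v → Fin 2 × List X × X × List X
    -- The letter `a` and the empty suffix are dummies here. The tag in `Fin 2` is compared by
    -- equality, so a word of this kind is never matched with one that has a letter above `a`.
    parts {a} (none {u} _)        = Fin.zero , u , a , []
    parts     (at u {b} t _ _) = Fin.suc Fin.zero , u , b , t

    drop↑ : ∀ {a u u′} → All (¬_ ∘ R a) u → Sublist (R ↑ a) u u′ → Sublist R u u′
    drop↑ n        []           = []
    drop↑ n        (y ∷ʳ s)     = y ∷ʳ drop↑ n s
    drop↑ (¬r ∷ n) (inj₁ r ∷ s) = r ∷ drop↑ n s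
    drop↑ (¬r ∷ n) (inj₂ r ∷ s) = contradiction r ¬r

  af-avoiding : AlmostFull R → (∀ a → AlmostFull (Sublist (R ↑ a))) →
                ∀ w → AlmostFull (Sublist R ↑ w)
  af-avoiding p q []      = now λ _ _ → inj₂ (minimum _)
  af-avoiding p q (a ∷ w) = af-mono combine (af-comap (parts ∘ firstAbove a)
    (af-∩ (af-comap proj₁ af-Fin-≡) (af-∩ (af-comap (proj₁ ∘ proj₂) (q a))
    (af-∩ (af-comap (proj₁ ∘ proj₂ ∘ proj₂) p)
          (af-comap (proj₂ ∘ proj₂ ∘ proj₂) (af-avoiding p q w))))))
    where
    combine : ∀ {v v′} → let (i , u , b , t) = parts (firstAbove a v)
                             (i′ , u′ , b′ , t′) = parts (firstAbove a v′) in
              i ≡ i′ × Sublist (R ↑ a) u u′ × R b b′ × (Sublist R ↑ w) t t′ →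
              (Sublist R ↑ (a ∷ w)) v v′
    combine {v} {v′} c with firstAbove a v | firstAbove a v′ | c
    ... | none n        | none _        | _ , s , _ , _       = inj₁ (drop↑ n s)
    ... | at u t n r | at _ _ _ _ | _ , s , r′ , inj₁ z = inj₁ (++⁺ (drop↑ n s) (r′ ∷ z))
    ... | at u t n r | at _ _ _ _ | _ , s , r′ , inj₂ z = inj₂ (++ˡ u (r ∷ z))
    ... | none _        | at _ _ _ _ | () , _
    ... | at _ _ _ _ | none _        | () , _

higman : {R : Rel X 0ℓ} → Decidable R → AlmostFull R → AlmostFull (Sublist R)
higman {R = R} R? (now r) = af-mono sub (af-comap length af-≤)
  where
  sub : ∀ {u v} → length u ≤ length v → Sublist R u v
  sub {[]}    {v}     _       = minimum v
  sub {x ∷ u} {y ∷ v} (s≤s l) = r x y ∷ sub l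
higman R? p@(later g) = later (af-avoiding R? p
  (λ a → higman (λ x y → R? x y ⊎-dec R? a x) (g a)))

-- Labelled forests of bounded height

Tree : ℕ → ℕ → Set
Tree m zero    = ⊤
Tree m (suc j) = List (Fin m × Tree m j)

-- Siblings form a word, so Higman's lemma applies once per level. Each level is embedded into the
-- same level, which matters because `proc` names a binder after its level.
_≼_ : ∀ {m j} → Rel (Tree m j) 0ℓ
_≼_ {j = zero}  _ _ = ⊤
_≼_ {m} {suc j} t u = Sublist (λ c d → proj₁ c ≡ proj₁ d × _≼_ {m} {j} (proj₂ c) (proj₂ d)) t u

≼? : ∀ {m} j → Decidable (_≼_ {m} {j})
≼? zero    _ _ = yes tt
≼? (suc j) = sublist? (λ c d → (proj₁ c Finₚ.≟ proj₁ d) ×-dec ≼? j (proj₂ c) (proj₂ d))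

af-≼ : ∀ {m} j → AlmostFull (_≼_ {m} {j})
af-≼ zero    = now λ _ _ → tt
af-≼ (suc j) = higman (λ c d → (proj₁ c Finₚ.≟ proj₁ d) ×-dec ≼? j (proj₂ c) (proj₂ d))
  (af-∩ (af-comap proj₁ af-Fin-≡) (af-comap proj₂ (af-≼ j)))

Inj : {A B : Set} → (A → B) → Set
Inj = Injective _≡_ _≡_

-- Names: the even numbers fr a stand for free names, the odd numbers bd m for bound names.

abstract
  double : ℕ → ℕ
  double zero    = zero
  double (suc m) = suc (suc (double m))

  join : ℕ ⊎ ℕ → ℕ
  join (inj₁ m) = double m
  join (inj₂ m) = suc (double m)

  next : ℕ ⊎ ℕ → ℕ ⊎ ℕ
  next (inj₁ m) = inj₂ m
  next (inj₂ m) = inj₁ (suc m)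

  split : ℕ → ℕ ⊎ ℕ
  split zero    = inj₁ zero
  split (suc n) = next (split n)

  split-double : ∀ m → split (double m) ≡ inj₁ m
  split-double zero    = refl
  split-double (suc m) = cong (next ∘ next) (split-double m)

  split-join : ∀ c → split (join c) ≡ c
  split-join (inj₁ m) = split-double m
  split-join (inj₂ m) = cong next (split-double m)

  join-next : ∀ c → join (next c) ≡ suc (join c)
  join-next (inj₁ m) = refl
  join-next (inj₂ m) = refl

  join-split : ∀ n → join (split n) ≡ n
  join-split zero    = refl
  join-split (suc n) = trans (join-next (split n)) (cong suc (join-split n))

  join-injective : Inj join
  join-injective {c} {d} eq = trans (sym (split-join c)) (trans (cong split eq) (split-join d))

  split-injective : Inj split
  split-injective {m} {n} eq = trans (sym (join-split m)) (trans (cong join eq) (join-split n))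

  on : (ℕ ⊎ ℕ → ℕ ⊎ ℕ) → ℕ → ℕ
  on f = join ∘ f ∘ split

  on-join : ∀ f c → on f (join c) ≡ join (f c)
  on-join f c = cong (join ∘ f) (split-join c)

  on-injective : ∀ {f} → Inj f → Inj (on f)
  on-injective f-inj = split-injective ∘ f-inj ∘ join-injective

map-injective : ∀ {f g : ℕ → ℕ} → Inj f → Inj g → Inj (Sum.map f g)
map-injective f-inj g-inj {inj₁ a} {inj₁ b} eq = cong inj₁ (f-inj (inj₁-injective eq))
map-injective f-inj g-inj {inj₂ a} {inj₂ b} eq = cong inj₂ (g-inj (inj₂-injective eq))

fr bd : ℕ → Name
fr a = join (inj₁ a)
bd m = join (inj₂ m)

data FreeOrBound : Name → Set where
  free  : ∀ a → FreeOrBound (fr a)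
  bound : ∀ m → FreeOrBound (bd m)

freeOrBound : ∀ n → FreeOrBound n
freeOrBound n = subst FreeOrBound (join-split n) (view (split n))
  where
  view : ∀ c → FreeOrBound (join c)
  view (inj₁ a) = free a
  view (inj₂ m) = bound m

fr-injective : Inj fr
fr-injective = inj₁-injective ∘ join-injective

bd-injective : Inj bd
bd-injective = inj₂-injective ∘ join-injective

fr≢bd : ∀ {a m} → fr a ≢ bd m
fr≢bd eq with join-injective eq
... | ()

abstract
  renFree renBound : (ℕ → ℕ) → Name → Name
  renFree f  = on (Sum.map f id)
  renBound f = on (Sum.map id f)

  renFree-injective : ∀ {f} → Inj f → Inj (renFree f)
  renFree-injective f-inj = on-injective (map-injective f-inj id)

  renBound-injective : ∀ {f} → Inj f → Inj (renBound f)
  renBound-injective f-inj = on-injective (map-injective id f-inj)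

  renFree-fr : ∀ f a → renFree f (fr a) ≡ fr (f a)
  renFree-fr f a = on-join (Sum.map f id) (inj₁ a)

  renFree-bd : ∀ f m → renFree f (bd m) ≡ bd m
  renFree-bd f m = on-join (Sum.map f id) (inj₂ m)

  renBound-fr : ∀ f a → renBound f (fr a) ≡ fr a
  renBound-fr f a = on-join (Sum.map id f) (inj₁ a)

  renBound-bd : ∀ f m → renBound f (bd m) ≡ bd (f m)
  renBound-bd f m = on-join (Sum.map id f) (inj₂ m)

renFree-renBound : ∀ f g n → renFree f (renBound g n) ≡ renBound g (renFree f n)
renFree-renBound f g n with freeOrBound n
... | free a  = trans (cong (renFree f) (renBound-fr g a)) (trans (renFree-fr f a)
                  (sym (trans (cong (renBound g) (renFree-fr f a)) (renBound-fr g (f a)))))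
... | bound m = trans (cong (renFree f) (renBound-bd g m)) (trans (renFree-bd f (g m))
                  (sym (trans (cong (renBound g) (renFree-bd f m)) (renBound-bd g m))))

renBound-∘ : ∀ f g n → renBound f (renBound g n) ≡ renBound (f ∘ g) n
renBound-∘ f g n with freeOrBound n
... | free a  = trans (cong (renBound f) (renBound-fr g a)) (trans (renBound-fr f a) (sym (renBound-fr (f ∘ g) a)))
... | bound m = trans (cong (renBound f) (renBound-bd g m)) (trans (renBound-bd f (g m)) (sym (renBound-bd (f ∘ g) m)))

renBound-id : ∀ n → renBound id n ≡ n
renBound-id n with freeOrBound n
... | free a  = renBound-fr id a
... | bound m = renBound-bd id m

abstract
  bindTo : (x a : ℕ) → Dec (a ≡ x) → ℕ ⊎ ℕ
  bindTo x a (yes _) = inj₂ 0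
  bindTo x a (no _)  = inj₁ a

  bindSum : Name → ℕ ⊎ ℕ → ℕ ⊎ ℕ
  bindSum x (inj₁ a) = bindTo x a (a ≟ x)
  bindSum x (inj₂ m) = inj₂ (suc m)

  -- ν x turns the free name x into the bound name 0 and shifts the other bound names.
  bind : Name → Name → Name
  bind x = on (bindSum x)

  bind-fr≡ : ∀ x → bind x (fr x) ≡ bd 0
  bind-fr≡ x = trans (on-join (bindSum x) (inj₁ x)) (cong join (lemma (x ≟ x)))
    where
    lemma : (d : Dec (x ≡ x)) → bindTo x x d ≡ inj₂ 0
    lemma (yes _)  = refl
    lemma (no x≢x) = contradiction refl x≢x

  bind-fr≢ : ∀ {x a} → a ≢ x → bind x (fr a) ≡ fr a
  bind-fr≢ {x} {a} a≢x = trans (on-join (bindSum x) (inj₁ a)) (cong join (lemma (a ≟ x)))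
    where
    lemma : (d : Dec (a ≡ x)) → bindTo x a d ≡ inj₁ a
    lemma (yes a≡x) = contradiction a≡x a≢x
    lemma (no _)    = refl

  bind-bd : ∀ x m → bind x (bd m) ≡ bd (suc m)
  bind-bd x m = on-join (bindSum x) (inj₂ m)

  -- The image of bind x avoids fr x, whence injectivity.
  bind-injective : ∀ x → Inj (bind x)
  bind-injective x = on-injective λ {c} {d} → inj c d
    where
    inj : ∀ c d → bindSum x c ≡ bindSum x d → c ≡ d
    inj (inj₁ a) (inj₁ b) eq with a ≟ x | b ≟ x
    ... | yes refl | yes refl = refl
    inj (inj₁ a) (inj₁ b) () | yes _ | no _
    inj (inj₁ a) (inj₁ b) () | no _  | yes _
    inj (inj₁ a) (inj₁ b) eq | no _  | no _ = eq
    inj (inj₁ a) (inj₂ n) eq with a ≟ x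
    inj (inj₁ a) (inj₂ n) () | yes _
    inj (inj₁ a) (inj₂ n) () | no _
    inj (inj₂ m) (inj₁ b) eq with b ≟ x
    inj (inj₂ m) (inj₁ b) () | yes _
    inj (inj₂ m) (inj₁ b) () | no _
    inj (inj₂ m) (inj₂ n) refl = refl

-- Here `f` renames below the binder and `g` outside it. They may differ at `x`, which becomes
-- bound, and `g a ≢ y` is capture avoidance. With `f` equal to `g` this serves for swapping,
-- otherwise for giving a binder its level name.
bind-renFree : ∀ {f g x y} → f x ≡ y → (∀ a → a ≢ x → f a ≡ g a × g a ≢ y) →
               ∀ n → bind y (renFree f n) ≡ renFree g (bind x n)
bind-renFree {f} {g} {x} {y} fx≡y avoid n with freeOrBound n
... | bound m = trans (cong (bind y) (renFree-bd f m)) (trans (bind-bd y m)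
                  (sym (trans (cong (renFree g) (bind-bd x m)) (renFree-bd g (suc m)))))
... | free a with a ≟ x
...   | yes refl = trans (cong (bind y) (trans (renFree-fr f x) (cong fr fx≡y))) (trans (bind-fr≡ y)
                     (sym (trans (cong (renFree g) (bind-fr≡ x)) (renFree-bd g 0))))
...   | no a≢x with avoid a a≢x
...     | fa≡ga , ga≢y =
  trans (cong (bind y) (trans (renFree-fr f a) (cong fr fa≡ga))) (trans (bind-fr≢ ga≢y)
    (sym (trans (cong (renFree g) (bind-fr≢ a≢x)) (renFree-fr g a))))

underBinder : (ℕ → ℕ) → ℕ → ℕ
underBinder f zero    = zero
underBinder f (suc m) = suc (f m)

underBinder-injective : ∀ {f} → Inj f → Inj (underBinder f)
underBinder-injective f-inj {zero}  {zero}  eq = refl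
underBinder-injective f-inj {suc m} {suc n} eq = cong suc (f-inj (suc-injective eq))

bind-renBound : ∀ f x n → bind x (renBound f n) ≡ renBound (underBinder f) (bind x n)
bind-renBound f x n with freeOrBound n
... | bound m = trans (cong (bind x) (renBound-bd f m)) (trans (bind-bd x (f m))
                  (sym (trans (cong (renBound _) (bind-bd x m)) (renBound-bd _ (suc m)))))
... | free a with a ≟ x
...   | yes refl = trans (cong (bind x) (renBound-fr f x)) (trans (bind-fr≡ x)
                     (sym (trans (cong (renBound _) (bind-fr≡ x)) (renBound-bd _ 0))))
...   | no a≢x = trans (cong (bind x) (renBound-fr f a)) (trans (bind-fr≢ a≢x)
                     (sym (trans (cong (renBound _) (bind-fr≢ a≢x)) (renBound-fr _ a))))

-- Parallel composition sends the bound names of its two sides to even and odd positions.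
evens odds : ℕ → ℕ
evens m = join (inj₁ m)
odds m  = join (inj₂ m)

lft rgt : Name → Name
lft = renBound evens
rgt = renBound odds

lft-injective : Inj lft
lft-injective = renBound-injective fr-injective

rgt-injective : Inj rgt
rgt-injective = renBound-injective bd-injective

renBound-cong : ∀ {f g} → (∀ m → f m ≡ g m) → ∀ n → renBound f n ≡ renBound g n
renBound-cong {f} {g} eq n with freeOrBound n
... | free a  = trans (renBound-fr f a) (sym (renBound-fr g a))
... | bound m = trans (renBound-bd f m) (trans (cong bd (eq m)) (sym (renBound-bd g m)))

index : Name → ℕ
index = [ id , id ]′ ∘ split

index-bd : ∀ m → index (bd m) ≡ m
index-bd m = cong [ id , id ]′ (split-join (inj₂ m))

-- Transpositions, and injections prescribed on finite lists

≡ᵇ-refl : ∀ n → (n ≡ᵇ n) ≡ true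
≡ᵇ-refl zero    = refl
≡ᵇ-refl (suc n) = ≡ᵇ-refl n

≢⇒≡ᵇ : ∀ {m n} → m ≢ n → (m ≡ᵇ n) ≡ false
≢⇒≡ᵇ {zero}  {zero}  ne = contradiction refl ne
≢⇒≡ᵇ {zero}  {suc n} ne = refl
≢⇒≡ᵇ {suc m} {zero}  ne = refl
≢⇒≡ᵇ {suc m} {suc n} ne = ≢⇒≡ᵇ (ne ∘ cong suc)

-- Definitionally equal to swapName, without its signature arguments.
transpose : Name → Name → Name → Name
transpose x y a = if a ≡ᵇ x then y else (if a ≡ᵇ y then x else a)

transpose-left : ∀ x y → transpose x y x ≡ y
transpose-left x y rewrite ≡ᵇ-refl x = refl

transpose-right : ∀ x y → transpose x y y ≡ x
transpose-right x y with y ≟ x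
... | yes refl rewrite ≡ᵇ-refl x = refl
... | no y≢x rewrite ≢⇒≡ᵇ y≢x | ≡ᵇ-refl y = refl

transpose-other : ∀ {x y a} → a ≢ x → a ≢ y → transpose x y a ≡ a
transpose-other a≢x a≢y rewrite ≢⇒≡ᵇ a≢x | ≢⇒≡ᵇ a≢y = refl

transpose-involutive : ∀ x y a → transpose x y (transpose x y a) ≡ a
transpose-involutive x y a with a ≟ x
... | yes refl = trans (cong (transpose x y) (transpose-left x y)) (transpose-right x y)
... | no a≢x with a ≟ y
...   | yes refl = trans (cong (transpose x y) (transpose-right x y)) (transpose-left x y)
...   | no a≢y   = trans (cong (transpose x y) eq) eq
  where eq = transpose-other a≢x a≢y

transpose-injective : ∀ x y → Inj (transpose x y)
transpose-injective x y {a} {b} eq =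
  trans (sym (transpose-involutive x y a)) (trans (cong (transpose x y) eq) (transpose-involutive x y b))

-- An injective left inverse on all of ℕ exists only for surjective `f`, and `evens` and `odds` are
-- not surjective. On a finite list one transposition per element repairs the value at that element;
-- it disturbs no earlier one, because `g ∘ f` is injective.
partialInverse : ∀ {f : ℕ → ℕ} → Inj f → (xs : List ℕ) →
                 ∃[ g ] Inj g × (∀ {a} → a ∈ xs → g (f a) ≡ a)
partialInverse f-inj []       = id , id , λ ()
partialInverse {f} f-inj (x ∷ xs) with partialInverse f-inj xs
... | g , g-inj , inv = transpose (g (f x)) x ∘ g , g-inj ∘ transpose-injective _ x , inv′
  where
  inv′ : ∀ {a} → a ∈ x ∷ xs → transpose (g (f x)) x (g (f a)) ≡ a
  inv′ (here refl) = transpose-left (g (f x)) x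
  inv′ {a} (there a∈xs) with a ≟ x
  ... | yes refl = transpose-left (g (f x)) x
  ... | no a≢x rewrite inv a∈xs =
    transpose-other (λ a≡ → a≢x (f-inj (g-inj (trans (inv a∈xs) a≡)))) a≢x

-- A value that is still too large is exchanged with `n + length xs`, the one slot by which the
-- bound grows. Values that are already small are neither of the two exchanged numbers and stay put.
compress : ∀ n (xs : List ℕ) →
           ∃[ g ] Inj g × (∀ {a} → a < n → g a ≡ a) × (∀ {a} → a ∈ xs → g a < n + length xs)
compress n []       = id , id , (λ _ → refl) , λ ()
compress n (x ∷ xs) with compress n xs
... | g , g-inj , fix , small with g x <? n + length xs
...   | yes gx< = g , g-inj , fix , λ { (here refl) → <-≤-trans gx< grow ; (there a∈) → <-≤-trans (small a∈) grow }
  where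
  grow : n + length xs ≤ n + suc (length xs)
  grow = +-monoʳ-≤ n (n≤1+n _)
...   | no gx≮ = transpose (g x) top ∘ g , g-inj ∘ transpose-injective _ top , fix′ , small′
  where
  top = n + length xs
  keep : ∀ {a} → g a < top → transpose (g x) top (g a) ≡ g a
  keep ga< = transpose-other (λ eq → gx≮ (subst (_< top) eq ga<)) (<⇒≢ ga<)
  top< : top < n + suc (length xs)
  top< = ≤-reflexive (sym (+-suc n (length xs)))
  fix′ : ∀ {a} → a < n → transpose (g x) top (g a) ≡ a
  fix′ a<n = trans (keep (subst (_< top) (sym (fix a<n)) (<-≤-trans a<n (m≤m+n n _)))) (fix a<n)
  small′ : ∀ {a} → a ∈ x ∷ xs → transpose (g x) top (g a) < n + suc (length xs)
  small′ (here refl) = subst (_< _) (sym (transpose-left (g x) top)) top<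
  small′ (there a∈)  = subst (_< _) (sym (keep (small a∈))) (<-trans (small a∈) top<)

-- Messages

module _ {S : Signature} where

  mutual
    rename-cong : ∀ {f g} (M : Msg S) → (∀ {a} → a ∈nm M → f a ≡ g a) → rename f M ≡ rename g M
    rename-cong (name a)   eq = cong name (eq nm-name)
    rename-cong (app f Ms) eq = cong (app f) (renames-cong Ms (eq ∘ nm-app))

    renames-cong : ∀ {f g n} (Ms : Vec (Msg S) n) → (∀ {a} → a ∈nms Ms → f a ≡ g a) → renames f Ms ≡ renames g Ms
    renames-cong []       eq = refl
    renames-cong (M ∷ Ms) eq = cong₂ _∷_ (rename-cong M (eq ∘ nms-here)) (renames-cong Ms (eq ∘ nms-there))

  mutual
    rename-∘ : ∀ f g (M : Msg S) → rename f (rename g M) ≡ rename (f ∘ g) M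
    rename-∘ f g (name a)   = refl
    rename-∘ f g (app h Ms) = cong (app h) (renames-∘ f g Ms)

    renames-∘ : ∀ f g {n} (Ms : Vec (Msg S) n) → renames f (renames g Ms) ≡ renames (f ∘ g) Ms
    renames-∘ f g []       = refl
    renames-∘ f g (M ∷ Ms) = cong₂ _∷_ (rename-∘ f g M) (renames-∘ f g Ms)

  mutual
    rename-id : (M : Msg S) → rename id M ≡ M
    rename-id (name a)   = refl
    rename-id (app f Ms) = cong (app f) (renames-id Ms)

    renames-id : ∀ {n} (Ms : Vec (Msg S) n) → renames id Ms ≡ Ms
    renames-id []       = refl
    renames-id (M ∷ Ms) = cong₂ _∷_ (rename-id M) (renames-id Ms)

  mutual
    ∈nm-rename⁺ : ∀ f {a} {M : Msg S} → a ∈nm M → f a ∈nm rename f M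
    ∈nm-rename⁺ f nm-name    = nm-name
    ∈nm-rename⁺ f (nm-app p) = nm-app (∈nms-renames⁺ f p)

    ∈nms-renames⁺ : ∀ f {a n} {Ms : Vec (Msg S) n} → a ∈nms Ms → f a ∈nms renames f Ms
    ∈nms-renames⁺ f (nms-here p)  = nms-here (∈nm-rename⁺ f p)
    ∈nms-renames⁺ f (nms-there p) = nms-there (∈nms-renames⁺ f p)

  mutual
    ∈nm-rename⁻ : ∀ f {a} (M : Msg S) → a ∈nm rename f M → ∃[ b ] b ∈nm M × a ≡ f b
    ∈nm-rename⁻ f (name b)   nm-name    = b , nm-name , refl
    ∈nm-rename⁻ f (app g Ms) (nm-app p) with ∈nms-renames⁻ f Ms p
    ... | b , q , eq = b , nm-app q , eq

    ∈nms-renames⁻ : ∀ f {a n} (Ms : Vec (Msg S) n) → a ∈nms renames f Ms → ∃[ b ] b ∈nms Ms × a ≡ f b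
    ∈nms-renames⁻ f (M ∷ Ms) (nms-here p) with ∈nm-rename⁻ f M p
    ... | b , q , eq = b , nms-here q , eq
    ∈nms-renames⁻ f (M ∷ Ms) (nms-there p) with ∈nms-renames⁻ f Ms p
    ... | b , q , eq = b , nms-there q , eq

  mutual
    size-rename : ∀ f (M : Msg S) → size (rename f M) ≡ size M
    size-rename f (name a)   = refl
    size-rename f (app g Ms) = cong suc (sizes-renames f Ms)

    sizes-renames : ∀ f {n} (Ms : Vec (Msg S) n) → sizes (renames f Ms) ≡ sizes Ms
    sizes-renames f []       = refl
    sizes-renames f (M ∷ Ms) = cong₂ _⊔_ (size-rename f M) (sizes-renames f Ms)

  mutual
    namesOf : Msg S → List Name
    namesOf (name a)   = a ∷ []
    namesOf (app f Ms) = namesOfs Ms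

    namesOfs : ∀ {n} → Vec (Msg S) n → List Name
    namesOfs []       = []
    namesOfs (M ∷ Ms) = namesOf M ++ namesOfs Ms

  mutual
    ∈-namesOf : ∀ {a} {M : Msg S} → a ∈nm M → a ∈ namesOf M
    ∈-namesOf nm-name    = here refl
    ∈-namesOf (nm-app p) = ∈-namesOfs p

    ∈-namesOfs : ∀ {a n} {Ms : Vec (Msg S) n} → a ∈nms Ms → a ∈ namesOfs Ms
    ∈-namesOfs (nms-here p)           = ∈-++⁺ˡ (∈-namesOf p)
    ∈-namesOfs (nms-there {M = M} p) = ∈-++⁺ʳ (namesOf M) (∈-namesOfs p)

  map-rename-cong : ∀ {f g} (Γ : List (Msg S)) → (∀ {a} → a ∈names Γ → f a ≡ g a) →
                    map (rename f) Γ ≡ map (rename g) Γ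
  map-rename-cong Γ eq = map-cong-local (All.tabulate λ {M} M∈ → rename-cong M (λ a∈ → eq (lose M∈ a∈)))

  map-rename-∘ : ∀ f g (Γ : List (Msg S)) → map (rename f) (map (rename g) Γ) ≡ map (rename (f ∘ g)) Γ
  map-rename-∘ f g Γ = trans (sym (map-∘ Γ)) (map-cong-local (All.tabulate λ {M} _ → rename-∘ f g M))

  map-rename-id : (Γ : List (Msg S)) → map (rename id) Γ ≡ Γ
  map-rename-id []      = refl
  map-rename-id (M ∷ Γ) = cong₂ _∷_ (rename-id M) (map-rename-id Γ)

  ∈names-ren⁻ : ∀ f {a} (Γ : List (Msg S)) → a ∈names map (rename f) Γ → ∃[ b ] b ∈names Γ × a ≡ f b
  ∈names-ren⁻ f (M ∷ Γ) (here p) with ∈nm-rename⁻ f M p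
  ... | b , b∈ , eq = b , here b∈ , eq
  ∈names-ren⁻ f (M ∷ Γ) (there p) with ∈names-ren⁻ f Γ p
  ... | b , b∈ , eq = b , there b∈ , eq

-- Standard forms

Call : Signature → Signature → Set
Call S QS = Σ[ q ∈ Fin (nsym QS) ] Vec (Msg S) (arity QS q)

infix 4 _∣_
record Sem (S QS : Signature) : Set where
  constructor _∣_
  field
    kn : List (Msg S)
    cl : List (Call S QS)
open Sem

module _ {S QS : Signature} where

  infix 4 _∈cls_ _∈sem_
  infixr 5 _⊕_

  renCall : (Name → Name) → Call S QS → Call S QS
  renCall f (q , Ms) = q , renames f Ms

  _∈cls_ : Name → List (Call S QS) → Set
  a ∈cls cs = Any (λ c → a ∈nms proj₂ c) cs

  _∈sem_ : Name → Sem S QS → Set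
  a ∈sem T = a ∈names kn T ⊎ a ∈cls cl T

  ren : (Name → Name) → Sem S QS → Sem S QS
  ren f (Γ ∣ cs) = map (rename f) Γ ∣ map (renCall f) cs

  ∅ : Sem S QS
  ∅ = [] ∣ []

  _⊕_ : Sem S QS → Sem S QS → Sem S QS
  (Γ ∣ cs) ⊕ (Δ ∣ ds) = (Γ ++ Δ) ∣ (cs ++ ds)

  -- A binder survives only in the codes of the occurrences it binds: its name is forgotten, and a
  -- vacuous binder disappears.
  ⟦_⟧ : Proc S QS → Sem S QS
  ⟦ 𝟘 ⟧         = ∅
  ⟦ ν x P ⟧     = ren (bind x) ⟦ P ⟧
  ⟦ P ∥ Q ⟧     = ren lft ⟦ P ⟧ ⊕ ren rgt ⟦ Q ⟧
  ⟦ ⟪ M ⟫ ⟧     = (rename fr M ∷ []) ∣ []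
  ⟦ call q Ms ⟧ = [] ∣ ((q , renames fr Ms) ∷ [])

  map-renCall-cong : ∀ {f g} cs → (∀ {a} → a ∈cls cs → f a ≡ g a) →
                     map (renCall f) cs ≡ map (renCall g) cs
  map-renCall-cong cs eq =
    map-cong-local (All.tabulate λ { {q , Ms} c∈ → cong (q ,_) (renames-cong Ms (λ a∈ → eq (lose c∈ a∈))) })

  map-renCall-∘ : ∀ f g (cs : List (Call S QS)) → map (renCall f) (map (renCall g) cs) ≡ map (renCall (f ∘ g)) cs
  map-renCall-∘ f g cs =
    trans (sym (map-∘ cs)) (map-cong-local (All.tabulate λ { {q , Ms} _ → cong (q ,_) (renames-∘ f g Ms) }))

  map-renCall-id : (cs : List (Call S QS)) → map (renCall id) cs ≡ cs
  map-renCall-id []              = refl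
  map-renCall-id ((q , Ms) ∷ cs) = cong₂ _∷_ (cong (q ,_) (renames-id Ms)) (map-renCall-id cs)

  ren-cong : ∀ {f g} T → (∀ {a} → a ∈sem T → f a ≡ g a) → ren f T ≡ ren g T
  ren-cong (Γ ∣ cs) eq = cong₂ _∣_ (map-rename-cong Γ (eq ∘ inj₁)) (map-renCall-cong cs (eq ∘ inj₂))

  ren-∘ : ∀ f g T → ren f (ren g T) ≡ ren (f ∘ g) T
  ren-∘ f g (Γ ∣ cs) = cong₂ _∣_ (map-rename-∘ f g Γ) (map-renCall-∘ f g cs)

  ren-id : ∀ T → ren id T ≡ T
  ren-id (Γ ∣ cs) = cong₂ _∣_ (map-rename-id Γ) (map-renCall-id cs)

  ren-⊕ : ∀ f T U → ren f (T ⊕ U) ≡ ren f T ⊕ ren f U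
  ren-⊕ f (Γ ∣ cs) (Δ ∣ ds) = cong₂ _∣_ (map-++ (rename f) Γ Δ) (map-++ (renCall f) cs ds)

  ⊕-assoc : ∀ T U V → (T ⊕ U) ⊕ V ≡ T ⊕ (U ⊕ V)
  ⊕-assoc (Γ ∣ cs) (Δ ∣ ds) (Ε ∣ es) = cong₂ _∣_ (++-assoc Γ Δ Ε) (++-assoc cs ds es)

  ⊕-identityʳ : ∀ T → T ⊕ ∅ ≡ T
  ⊕-identityʳ (Γ ∣ cs) = cong₂ _∣_ (++-identityʳ Γ) (++-identityʳ cs)

  ∈cls-ren⁻ : ∀ f {a} cs → a ∈cls map (renCall f) cs → ∃[ b ] b ∈cls cs × a ≡ f b
  ∈cls-ren⁻ f ((q , Ms) ∷ cs) (here p) with ∈nms-renames⁻ f Ms p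
  ... | b , b∈ , eq = b , here b∈ , eq
  ∈cls-ren⁻ f (c ∷ cs) (there p) with ∈cls-ren⁻ f cs p
  ... | b , b∈ , eq = b , there b∈ , eq

  ∈cls-ren⁺ : ∀ f {a} {cs} → a ∈cls cs → f a ∈cls map (renCall f) cs
  ∈cls-ren⁺ f p = Anyₚ.map⁺ (Any.map (∈nms-renames⁺ f) p)

  ∈sem-ren⁺ : ∀ f {a} {T} → a ∈sem T → f a ∈sem ren f T
  ∈sem-ren⁺ f (inj₁ p) = inj₁ (Anyₚ.map⁺ (Any.map (∈nm-rename⁺ f) p))
  ∈sem-ren⁺ f (inj₂ p) = inj₂ (∈cls-ren⁺ f p)

  ∈sem-ren⁻ : ∀ f {a} T → a ∈sem ren f T → ∃[ b ] b ∈sem T × a ≡ f b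
  ∈sem-ren⁻ f (Γ ∣ cs) (inj₁ p) with ∈names-ren⁻ f Γ p
  ... | b , b∈ , eq = b , inj₁ b∈ , eq
  ∈sem-ren⁻ f (Γ ∣ cs) (inj₂ p) with ∈cls-ren⁻ f cs p
  ... | b , b∈ , eq = b , inj₂ b∈ , eq

  ∈sem-⊕⁻ : ∀ {a} T U → a ∈sem T ⊕ U → a ∈sem T ⊎ a ∈sem U
  ∈sem-⊕⁻ (Γ ∣ cs) U (inj₁ p) = Sum.map inj₁ inj₁ (Anyₚ.++⁻ Γ p)
  ∈sem-⊕⁻ (Γ ∣ cs) U (inj₂ p) = Sum.map inj₂ inj₂ (Anyₚ.++⁻ cs p)

  names : Sem S QS → List Name
  names (Γ ∣ cs) = concatMap namesOf Γ ++ concatMap (namesOfs ∘ proj₂) cs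

  ∈-names : ∀ {a} T → a ∈sem T → a ∈ names T
  ∈-names (Γ ∣ cs) (inj₁ p) = ∈-++⁺ˡ (∈-concatMap⁺ namesOf (Any.map ∈-namesOf p))
  ∈-names (Γ ∣ cs) (inj₂ p) =
    ∈-++⁺ʳ (concatMap namesOf Γ) (∈-concatMap⁺ (namesOfs ∘ proj₂) (Any.map ∈-namesOfs p))

  -- The codes given to all binders of the process, including the vacuous ones that do not show in
  -- `⟦ P ⟧`; `readback` turns them into the restriction prefix.
  bn : Proc S QS → List Name
  bn (ν x P) = bd 0 ∷ map (bind x) (bn P)
  bn (P ∥ Q) = map lft (bn P) ++ map rgt (bn Q)
  bn _       = []

  bn-bound : ∀ P {n} → n ∈ bn P → ∃[ m ] n ≡ bd m
  bn-bound (ν x P) (here eq) = 0 , eq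
  bn-bound (ν x P) (there p) with ∈-map⁻ (bind x) p
  ... | n , n∈ , refl with bn-bound P n∈
  ...   | m , refl = suc m , bind-bd x m
  bn-bound (P ∥ Q) p with ∈-++⁻ (map lft (bn P)) p
  ... | inj₁ q with ∈-map⁻ lft q
  ...   | n , n∈ , refl with bn-bound P n∈
  ...     | m , refl = _ , renBound-bd evens m
  bn-bound (P ∥ Q) p | inj₂ q with ∈-map⁻ rgt q
  ...   | n , n∈ , refl with bn-bound Q n∈
  ...     | m , refl = _ , renBound-bd odds m

  data Origin (P : Proc S QS) : Name → Set where
    free  : ∀ {a} → a ∈fn P → Origin P (fr a)
    bound : ∀ {n} → n ∈ bn P → Origin P n

  origin : ∀ P {n} → n ∈sem ⟦ P ⟧ → Origin P n
  origin 𝟘 (inj₁ ())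
  origin 𝟘 (inj₂ ())
  origin (ν x P) p with ∈sem-ren⁻ (bind x) ⟦ P ⟧ p
  ... | b , b∈ , refl with origin P b∈
  ...   | bound q = bound (there (∈-map⁺ (bind x) q))
  ...   | free {a} q with a ≟ x
  ...     | yes refl = bound (here (bind-fr≡ x))
  ...     | no a≢x   = subst (Origin (ν x P)) (sym (bind-fr≢ a≢x)) (free (fn-ν a≢x q))
  origin (P ∥ Q) p with ∈sem-⊕⁻ (ren lft ⟦ P ⟧) _ p
  ... | inj₁ l with ∈sem-ren⁻ lft ⟦ P ⟧ l
  ...   | b , b∈ , refl with origin P b∈
  ...     | bound q = bound (∈-++⁺ˡ (∈-map⁺ lft q))
  ...     | free {a} q = subst (Origin (P ∥ Q)) (sym (renBound-fr evens a)) (free (fn-∥ˡ q))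
  origin (P ∥ Q) p | inj₂ r with ∈sem-ren⁻ rgt ⟦ Q ⟧ r
  ...   | b , b∈ , refl with origin Q b∈
  ...     | bound q = bound (∈-++⁺ʳ (map lft (bn P)) (∈-map⁺ rgt q))
  ...     | free {a} q = subst (Origin (P ∥ Q)) (sym (renBound-fr odds a)) (free (fn-∥ʳ q))
  origin ⟪ M ⟫ (inj₁ (here p)) with ∈nm-rename⁻ fr M p
  ... | b , b∈ , refl = free (fn-msg b∈)
  origin ⟪ M ⟫ (inj₂ ())
  origin (call q Ms) (inj₁ ())
  origin (call q Ms) (inj₂ (here p)) with ∈nms-renames⁻ fr Ms p
  ... | b , b∈ , refl = free (fn-call b∈)

  fr∈⟦⟧⇒∈fn : ∀ P {a} → fr a ∈sem ⟦ P ⟧ → a ∈fn P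
  fr∈⟦⟧⇒∈fn P {a} p = lemma refl (origin P p)
    where
    lemma : ∀ {n} → n ≡ fr a → Origin P n → a ∈fn P
    lemma eq (free q)  = subst (_∈fn P) (fr-injective eq) q
    lemma eq (bound q) with bn-bound P q
    ... | m , refl = ⊥-elim (fr≢bd (sym eq))

  -- Swapping acts on binders and occurrences alike and is injective, so it never captures: what was
  -- bound stays bound by the same binder, and only the codes of free names change.
  ⟦swapP⟧ : ∀ x y P → ⟦ swapP x y P ⟧ ≡ ren (renFree (transpose x y)) ⟦ P ⟧
  ⟦swapP⟧ x y 𝟘           = refl
  ⟦swapP⟧ x y (ν z P)     = begin
    ren (bind (transpose x y z)) ⟦ swapP x y P ⟧                   ≡⟨ cong (ren _) (⟦swapP⟧ x y P) ⟩
    ren (bind (transpose x y z)) (ren (renFree (transpose x y)) ⟦ P ⟧) ≡⟨ ren-∘ _ _ ⟦ P ⟧ ⟩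
    ren (bind (transpose x y z) ∘ renFree (transpose x y)) ⟦ P ⟧   ≡⟨ ren-cong ⟦ P ⟧ (λ {n} _ → commute n) ⟩
    ren (renFree (transpose x y) ∘ bind z) ⟦ P ⟧                   ≡⟨ ren-∘ _ _ ⟦ P ⟧ ⟨
    ren (renFree (transpose x y)) (ren (bind z) ⟦ P ⟧)             ∎
    where
    open ≡-Reasoning
    commute : ∀ n → bind (transpose x y z) (renFree (transpose x y) n) ≡ renFree (transpose x y) (bind z n)
    commute = bind-renFree refl (λ a a≢z → refl , a≢z ∘ transpose-injective x y)
  ⟦swapP⟧ x y (P ∥ Q)     = begin
    ren lft ⟦ swapP x y P ⟧ ⊕ ren rgt ⟦ swapP x y Q ⟧ ≡⟨ cong₂ _⊕_ (side evens P) (side odds Q) ⟩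
    ren t (ren lft ⟦ P ⟧) ⊕ ren t (ren rgt ⟦ Q ⟧)     ≡⟨ ren-⊕ t (ren lft ⟦ P ⟧) (ren rgt ⟦ Q ⟧) ⟨
    ren t ⟦ P ∥ Q ⟧                                    ∎
    where
    open ≡-Reasoning
    t = renFree (transpose x y)
    side : ∀ f R → ren (renBound f) ⟦ swapP x y R ⟧ ≡ ren t (ren (renBound f) ⟦ R ⟧)
    side f R = begin
      ren (renBound f) ⟦ swapP x y R ⟧ ≡⟨ cong (ren _) (⟦swapP⟧ x y R) ⟩
      ren (renBound f) (ren t ⟦ R ⟧)   ≡⟨ ren-∘ _ _ ⟦ R ⟧ ⟩
      ren (renBound f ∘ t) ⟦ R ⟧       ≡⟨ ren-cong ⟦ R ⟧ (λ {n} _ → sym (renFree-renBound _ f n)) ⟩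
      ren (t ∘ renBound f) ⟦ R ⟧       ≡⟨ ren-∘ _ _ ⟦ R ⟧ ⟨
      ren t (ren (renBound f) ⟦ R ⟧)   ∎
  ⟦swapP⟧ x y ⟪ M ⟫       = cong (λ N → (N ∷ []) ∣ []) (begin
    rename fr (rename (transpose x y) M)          ≡⟨ rename-∘ _ _ M ⟩
    rename (fr ∘ transpose x y) M                 ≡⟨ rename-cong M (λ {a} _ → sym (renFree-fr _ a)) ⟩
    rename (renFree (transpose x y) ∘ fr) M       ≡⟨ rename-∘ _ _ M ⟨
    rename (renFree (transpose x y)) (rename fr M) ∎)
    where open ≡-Reasoning
  ⟦swapP⟧ x y (call q Ms) = cong (λ Ns → [] ∣ ((q , Ns) ∷ [])) (begin
    renames fr (renames (transpose x y) Ms)          ≡⟨ renames-∘ _ _ Ms ⟩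
    renames (fr ∘ transpose x y) Ms                  ≡⟨ renames-cong Ms (λ {a} _ → sym (renFree-fr _ a)) ⟩
    renames (renFree (transpose x y) ∘ fr) Ms        ≡⟨ renames-∘ _ _ Ms ⟨
    renames (renFree (transpose x y)) (renames fr Ms) ∎)
    where open ≡-Reasoning

-- The order on standard forms

module _ {S : Signature} (I : IntruderModel S) where
  open IntruderModel I

  ⊢-∈ : ∀ {Γ M} → M ∈ Γ → Γ ⊢ M
  ⊢-∈ M∈Γ = ⊢-mono (λ { (here refl) → M∈Γ }) (⊢-ax _)

  ⊢-cut* : ∀ {Γ Δ N} → (∀ {M} → M ∈ Γ → Δ ⊢ M) → Γ ⊢ N → Δ ⊢ N
  ⊢-cut* {Γ} {Δ} h ΓN = go Γ h (⊢-mono ∈-++⁺ˡ ΓN)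
    where
    go : ∀ Γ {N} → (∀ {M} → M ∈ Γ → Δ ⊢ M) → (Γ ++ Δ) ⊢ N → Δ ⊢ N
    go []      h d = d
    go (M ∷ Γ) h d = go Γ (h ∘ there) (⊢-cut (⊢-mono (∈-++⁺ʳ Γ) (h (here refl))) d)

module _ {S QS : Signature} (I : IntruderModel S) where
  open IntruderModel I

  infix 4 _≲_ _≋_

  record Embeds (f : Name → Name) (T U : Sem S QS) : Set where
    constructor _,_
    field
      knows : ∀ {M} → M ∈ kn T → kn U ⊢ rename f M
      calls : ∃[ cs ] cl U ↭ map (renCall f) (cl T) ++ cs

  embeds-cong : ∀ {f g T U} → (∀ {a} → a ∈sem T → f a ≡ g a) → Embeds f T U → Embeds g T U
  embeds-cong {T = T} {U} eq (k , cs , p) =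
    (λ {M} M∈ → subst (kn U ⊢_) (rename-cong M (λ a∈ → eq (inj₁ (lose M∈ a∈)))) (k M∈)) ,
    cs , subst (λ ds → cl U ↭ ds ++ cs) (map-renCall-cong (cl T) (eq ∘ inj₂)) p

  embeds-refl : ∀ {T} → Embeds id T T
  embeds-refl {T} = (λ {M} M∈ → subst (kn T ⊢_) (sym (rename-id M)) (⊢-∈ I M∈)) ,
    [] , ↭-reflexive (sym (trans (++-identityʳ _) (map-renCall-id (cl T))))

  -- Derivations from `kn U` are renamed along `g`, which is why `g` has to be injective; the
  -- renamed messages of `U` are then cut against `kn V`.
  embeds-trans : ∀ {f g T U V} → Inj g → Embeds f T U → Embeds g U V → Embeds (g ∘ f) T V
  embeds-trans {f} {g} {T} {U} {V} g-inj (k , cs , p) (l , ds , q) = knows′ , _ , calls′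
    where
    knows′ : ∀ {M} → M ∈ kn T → kn V ⊢ rename (g ∘ f) M
    knows′ {M} M∈ = subst (kn V ⊢_) (rename-∘ g f M) (⊢-cut* I derive (⊢-ren⇒ g g-inj (kn U) (rename f M) (k M∈)))
      where
      derive : ∀ {N} → N ∈ map (rename g) (kn U) → kn V ⊢ N
      derive N∈ with ∈-map⁻ (rename g) N∈
      ... | N′ , N′∈ , refl = l N′∈
    calls′ : cl V ↭ map (renCall (g ∘ f)) (cl T) ++ (map (renCall g) cs ++ ds)
    calls′ = ↭-trans q (↭-trans (↭ₚ.++⁺ʳ ds (↭ₚ.map⁺ (renCall g) p)) (↭-reflexive
      (trans (cong (_++ ds) (trans (map-++ (renCall g) (map (renCall f) (cl T)) cs)
                                   (cong (_++ _) (map-renCall-∘ g f (cl T)))))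
             (++-assoc _ (map (renCall g) cs) ds))))

  embeds-ren : ∀ {f T} → Embeds f T (ren f T)
  embeds-ren {f} {T} = (λ M∈ → ⊢-∈ I (∈-map⁺ (rename f) M∈)) , [] , ↭-reflexive (sym (++-identityʳ _))

  embeds-from-ren : ∀ {f g T U} → Embeds (g ∘ f) T U → Embeds g (ren f T) U
  embeds-from-ren {f} {g} {T} {U} (k , cs , p) = knows′ ,
    cs , subst (λ ds → cl U ↭ ds ++ cs) (sym (map-renCall-∘ g f (cl T))) p
    where
    knows′ : ∀ {M} → M ∈ kn (ren f T) → kn U ⊢ rename g M
    knows′ M∈ with ∈-map⁻ (rename f) M∈
    ... | N , N∈ , refl = subst (kn U ⊢_) (sym (rename-∘ g f N)) (k N∈)

  embeds-rens : ∀ {f g h T U} → Inj h → (∀ n → h (f n) ≡ g (h n)) →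
                Embeds f T U → Embeds g (ren h T) (ren h U)
  embeds-rens h-inj comm e =
    embeds-from-ren (embeds-cong (λ {n} _ → comm n) (embeds-trans h-inj e embeds-ren))

  embeds-⊕ : ∀ {f T T′ U U′} → Embeds f T T′ → Embeds f U U′ → Embeds f (T ⊕ U) (T′ ⊕ U′)
  embeds-⊕ {f} {T} {T′} {U} {U′} (k , cs , p) (l , ds , q) = knows′ , _ , calls′
    where
    knows′ : ∀ {M} → M ∈ kn (T ⊕ U) → kn (T′ ⊕ U′) ⊢ rename f M
    knows′ M∈ with ∈-++⁻ (kn T) M∈
    ... | inj₁ M∈T = ⊢-mono ∈-++⁺ˡ (k M∈T)
    ... | inj₂ M∈U = ⊢-mono (∈-++⁺ʳ (kn T′)) (l M∈U)
    calls′ : cl T′ ++ cl U′ ↭ map (renCall f) (cl T ++ cl U) ++ (cs ++ ds)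
    calls′ = ↭-trans (↭ₚ.++⁺ p q) (↭-trans (interchange (map (renCall f) (cl T)) cs (map (renCall f) (cl U)) ds)
      (↭-reflexive (cong (_++ _) (sym (map-++ (renCall f) (cl T) (cl U))))))
      where
      interchange : ∀ (a b c d : List (Call S QS)) → (a ++ b) ++ (c ++ d) ↭ (a ++ c) ++ (b ++ d)
      interchange a b c d = ↭-trans (↭-reflexive (++-assoc a b (c ++ d))) (↭-trans
        (↭ₚ.++⁺ˡ a (↭-trans (↭-reflexive (sym (++-assoc b c d))) (↭-trans
          (↭ₚ.++⁺ʳ d (↭ₚ.++-comm b c)) (↭-reflexive (++-assoc c b d)))))
        (↭-reflexive (sym (++-assoc a c (b ++ d)))))

  _≲_ : Sem S QS → Sem S QS → Set
  T ≲ U = ∃[ f ] Inj f × Embeds (renBound f) T U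

  _≋_ : Sem S QS → Sem S QS → Set
  T ≋ U = T ≲ U × U ≲ T

  ≲-refl : ∀ {T} → T ≲ T
  ≲-refl = id , id , embeds-cong (λ {n} _ → sym (renBound-id n)) embeds-refl

  ≲-trans : ∀ {T U V} → T ≲ U → U ≲ V → T ≲ V
  ≲-trans (f , f-inj , e) (g , g-inj , e′) = g ∘ f , f-inj ∘ g-inj ,
    embeds-cong (λ {n} _ → renBound-∘ g f n) (embeds-trans (renBound-injective g-inj) e e′)

  ≋-refl : ∀ {T} → T ≋ T
  ≋-refl = ≲-refl , ≲-refl

  ≋-reflexive : ∀ {T U} → T ≡ U → T ≋ U
  ≋-reflexive refl = ≋-refl

  ≋-sym : ∀ {T U} → T ≋ U → U ≋ T
  ≋-sym (p , q) = q , p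

  ≋-trans : ∀ {T U V} → T ≋ U → U ≋ V → T ≋ V
  ≋-trans (p , p′) (q , q′) = ≲-trans p q , ≲-trans q′ p′

  ≲-ren : ∀ {f T} → Inj f → T ≲ ren (renBound f) T
  ≲-ren f-inj = _ , f-inj , embeds-ren

  ren-≲ : ∀ {f} T → Inj f → ren (renBound f) T ≲ T
  -- `index` lists the numbers of free names too; a longer list only makes `g` invert `f` in more
  -- places.
  ren-≲ {f} T f-inj with partialInverse f-inj (map index (names T))
  ... | g , g-inj , inv = g , g-inj , embeds-from-ren (embeds-cong (λ {n} → undo n) embeds-refl)
    where
    undo : ∀ n → n ∈sem T → n ≡ renBound g (renBound f n)
    undo n n∈ with freeOrBound n
    ... | free a  = sym (trans (cong (renBound g) (renBound-fr f a)) (renBound-fr g a))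
    ... | bound m = sym (trans (cong (renBound g) (renBound-bd f m)) (trans (renBound-bd g (f m))
      (cong bd (inv (subst (_∈ map index (names T)) (index-bd m) (∈-map⁺ index (∈-names T n∈)))))))

  ≋-ren : ∀ {f} T → Inj f → T ≋ ren (renBound f) T
  ≋-ren T f-inj = ≲-ren f-inj , ren-≲ T f-inj

  ≲-bind : ∀ x {T U} → T ≲ U → ren (bind x) T ≲ ren (bind x) U
  ≲-bind x (f , f-inj , e) = underBinder f , underBinder-injective f-inj ,
    embeds-rens (bind-injective x) (bind-renBound f x) e

  -- The two sides use even and odd numbers, so both injections fit side by side into one.
  ≲-∥ : ∀ {T T′ U U′} → T ≲ T′ → U ≲ U′ → ren lft T ⊕ ren rgt U ≲ ren lft T′ ⊕ ren rgt U′
  ≲-∥ (f , f-inj , e) (g , g-inj , e′) = on (Sum.map f g) , on-injective (map-injective f-inj g-inj) ,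
    embeds-⊕ (embeds-rens lft-injective (commute evens f (λ m → on-join (Sum.map f g) (inj₁ m))) e)
             (embeds-rens rgt-injective (commute odds g (λ m → on-join (Sum.map f g) (inj₂ m))) e′)
    where
    commute : ∀ s h → (∀ m → on (Sum.map f g) (s m) ≡ s (h m)) → ∀ n →
              renBound s (renBound h n) ≡ renBound (on (Sum.map f g)) (renBound s n)
    commute s h eq n = trans (renBound-∘ s h n)
      (trans (renBound-cong (sym ∘ eq) n) (sym (renBound-∘ (on (Sum.map f g)) s n)))

  ≋-bind : ∀ x {T U} → T ≋ U → ren (bind x) T ≋ ren (bind x) U
  ≋-bind x (p , q) = ≲-bind x p , ≲-bind x q

  ≋-∥ : ∀ {T T′ U U′} → T ≋ T′ → U ≋ U′ → ren lft T ⊕ ren rgt U ≋ ren lft T′ ⊕ ren rgt U′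
  ≋-∥ (p , q) (p′ , q′) = ≲-∥ p p′ , ≲-∥ q q′

  -- This accounts for a tree that the forest embedding skips.
  ≲-weakenˡ : ∀ {T U V} → T ≲ V → T ≲ ren lft U ⊕ ren rgt V
  ≲-weakenˡ {T} {U} {V} T≲V = ≲-trans T≲V (odds , bd-injective ,
    (λ M∈ → ⊢-∈ I (∈-++⁺ʳ (kn (ren lft U)) (∈-map⁺ (rename rgt) M∈))) ,
    _ , ↭ₚ.++-comm (cl (ren lft U)) (cl (ren rgt V)))

  ⊕-comm-≲ : ∀ T U → T ⊕ U ≲ U ⊕ T
  ⊕-comm-≲ T U = id , id , embeds-cong (λ {n} _ → sym (renBound-id n))
    ((λ {M} M∈ → subst (kn (U ⊕ T) ⊢_) (sym (rename-id M)) (⊢-∈ I (swap∈ M∈))) ,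
     [] , ↭-trans (↭ₚ.++-comm (cl U) (cl T))
       (↭-reflexive (sym (trans (++-identityʳ _) (map-renCall-id (cl T ++ cl U))))))
    where
    swap∈ : ∀ {M} → M ∈ kn (T ⊕ U) → M ∈ kn (U ⊕ T)
    swap∈ M∈ with ∈-++⁻ (kn T) M∈
    ... | inj₁ p = ∈-++⁺ʳ (kn U) p
    ... | inj₂ p = ∈-++⁺ˡ p

  ⊕-comm-≋ : ∀ T U → T ⊕ U ≋ U ⊕ T
  ⊕-comm-≋ T U = ⊕-comm-≲ T U , ⊕-comm-≲ U T

-- Invariance under congruence

  -- Turns the numbering of binders in `(P ∥ Q) ∥ R` into that of `P ∥ (Q ∥ R)`: it is `assocʳ` read
  -- through the even and odd coding.
  regroup : ℕ → ℕ
  regroup = on (Sum.map id join ∘ assocʳ ∘ Sum.map split id)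

  regroup-injective : Inj regroup
  regroup-injective {m} {n} eq = on-injective
    (λ {c} {d} → map₁-split-injective {c} {d} ∘ assocʳ-injective ∘ map₂-join-injective) eq
    where
    map₁-split-injective : Inj (Sum.map {B = ℕ} split id)
    map₁-split-injective {inj₁ a} {inj₁ b} eq = cong inj₁ (split-injective (inj₁-injective eq))
    map₁-split-injective {inj₂ a} {inj₂ .a} refl = refl
    map₂-join-injective : Inj (Sum.map {A = ℕ} id join)
    map₂-join-injective {inj₁ a} {inj₁ .a} refl = refl
    map₂-join-injective {inj₂ a} {inj₂ b} eq = cong inj₂ (join-injective (inj₂-injective eq))
    assocʳ-injective : Inj (assocʳ {A = ℕ} {B = ℕ} {C = ℕ})
    assocʳ-injective {c} {d} eq = trans (sym (assocˡʳ c)) (trans (cong assocˡ eq) (assocˡʳ d))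
      where
      assocˡʳ : ∀ c → assocˡ {A = ℕ} {B = ℕ} {C = ℕ} (assocʳ c) ≡ c
      assocˡʳ (inj₁ (inj₁ _)) = refl
      assocˡʳ (inj₁ (inj₂ _)) = refl
      assocˡʳ (inj₂ _)        = refl

  ⟦assoc⟧ : ∀ p q r → ren lft (ren lft p ⊕ ren rgt q) ⊕ ren rgt r ≋
                      ren lft p ⊕ ren rgt (ren lft q ⊕ ren rgt r)
  ⟦assoc⟧ p q r = ≋-trans (≋-ren _ regroup-injective) (≋-reflexive (begin
    ren f (ren lft (ren lft p ⊕ ren rgt q) ⊕ ren rgt r)
      ≡⟨ ren-⊕ f (ren lft (ren lft p ⊕ ren rgt q)) (ren rgt r) ⟩
    ren f (ren lft (ren lft p ⊕ ren rgt q)) ⊕ ren f (ren rgt r)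
      ≡⟨ cong (λ T → ren f T ⊕ ren f (ren rgt r)) (ren-⊕ lft (ren lft p) (ren rgt q)) ⟩
    ren f (ren lft (ren lft p) ⊕ ren lft (ren rgt q)) ⊕ ren f (ren rgt r)
      ≡⟨ cong (_⊕ ren f (ren rgt r)) (ren-⊕ f (ren lft (ren lft p)) (ren lft (ren rgt q))) ⟩
    (ren f (ren lft (ren lft p)) ⊕ ren f (ren lft (ren rgt q))) ⊕ ren f (ren rgt r)
      ≡⟨ ⊕-assoc (ren f (ren lft (ren lft p))) (ren f (ren lft (ren rgt q))) (ren f (ren rgt r)) ⟩
    ren f (ren lft (ren lft p)) ⊕ (ren f (ren lft (ren rgt q)) ⊕ ren f (ren rgt r))
      ≡⟨ cong₂ _⊕_ eq₁ (cong₂ _⊕_ eq₂ eq₃) ⟩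
    ren lft p ⊕ (ren rgt (ren lft q) ⊕ ren rgt (ren rgt r))
      ≡⟨ cong (ren lft p ⊕_) (ren-⊕ rgt (ren lft q) (ren rgt r)) ⟨
    ren lft p ⊕ ren rgt (ren lft q ⊕ ren rgt r) ∎))
    where
    open ≡-Reasoning
    f = renBound regroup
    regroup-lft : ∀ m → regroup (evens m) ≡ join (Sum.map id join (assocʳ (inj₁ (split m))))
    regroup-lft m = on-join _ (inj₁ m)
    regroup-ll : ∀ m → regroup (evens (evens m)) ≡ evens m
    regroup-ll m = trans (regroup-lft _) (cong (λ c → join (Sum.map id join (assocʳ (inj₁ c)))) (split-join (inj₁ m)))
    regroup-lr : ∀ m → regroup (evens (odds m)) ≡ odds (evens m)
    regroup-lr m = trans (regroup-lft _) (cong (λ c → join (Sum.map id join (assocʳ (inj₁ c)))) (split-join (inj₂ m)))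
    regroup-r : ∀ m → regroup (odds m) ≡ odds (odds m)
    regroup-r m = on-join _ (inj₂ m)
    eq₁ : ren f (ren lft (ren lft p)) ≡ ren lft p
    eq₁ = trans (cong (ren f) (ren-∘ lft lft p)) (trans (ren-∘ f _ p) (ren-cong p λ {n} _ →
      trans (cong f (renBound-∘ _ _ n)) (trans (renBound-∘ _ _ n) (renBound-cong regroup-ll n))))
    eq₂ : ren f (ren lft (ren rgt q)) ≡ ren rgt (ren lft q)
    eq₂ = trans (cong (ren f) (ren-∘ lft rgt q)) (trans (trans (ren-∘ f _ q) (ren-cong q λ {n} _ →
      trans (cong f (renBound-∘ _ _ n)) (trans (renBound-∘ _ _ n) (trans (renBound-cong regroup-lr n)
        (sym (renBound-∘ _ _ n)))))) (sym (ren-∘ rgt lft q)))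
    eq₃ : ren f (ren rgt r) ≡ ren rgt (ren rgt r)
    eq₃ = trans (trans (ren-∘ f rgt r) (ren-cong r λ {n} _ →
      trans (renBound-∘ _ _ n) (trans (renBound-cong regroup-r n) (sym (renBound-∘ _ _ n))))) (sym (ren-∘ rgt rgt r))

  swapSides : ℕ → ℕ
  swapSides = on swap

  swap-injective : Inj (swap {A = ℕ} {B = ℕ})
  swap-injective {inj₁ _} {inj₁ _} refl = refl
  swap-injective {inj₂ _} {inj₂ _} refl = refl

  ⟦comm⟧ : ∀ p q → ren lft p ⊕ ren rgt q ≋ ren lft q ⊕ ren rgt p
  ⟦comm⟧ p q = ≋-trans (≋-ren _ (on-injective swap-injective)) (≋-trans (≋-reflexive
    (trans (ren-⊕ f (ren lft p) (ren rgt q)) (cong₂ _⊕_ (side {evens} {odds} p (on-join swap ∘ inj₁)) (side {odds} {evens} q (on-join swap ∘ inj₂)))))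
    (⊕-comm-≋ (ren rgt p) (ren lft q)))
    where
    f = renBound swapSides
    side : ∀ {s t} (T : Sem S QS) → (∀ m → swapSides (s m) ≡ t m) → ren f (ren (renBound s) T) ≡ ren (renBound t) T
    side T eq = trans (ren-∘ f _ T) (ren-cong T λ {n} _ → trans (renBound-∘ _ _ n) (renBound-cong eq n))

  -- The outer binder owns number 0 and the inner one number 1, so exchanging distinct binders
  -- transposes these numbers.
  ⟦νν⟧ : ∀ a b p → ren (bind a) (ren (bind b) p) ≋ ren (bind b) (ren (bind a) p)
  ⟦νν⟧ a b p with a ≟ b
  ... | yes refl = ≋-refl
  ... | no a≢b   = ≋-trans (≋-ren _ (transpose-injective 0 1)) (≋-reflexive
    (trans (cong (ren f) (ren-∘ (bind a) (bind b) p)) (trans (ren-∘ f _ p)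
      (trans (ren-cong p (λ {n} _ → eq n)) (sym (ren-∘ (bind b) (bind a) p))))))
    where
    f = renBound (transpose 0 1)
    eq : ∀ n → f (bind a (bind b n)) ≡ bind b (bind a n)
    eq n with freeOrBound n
    ... | bound m rewrite bind-bd b m | bind-bd a m | bind-bd a (suc m) | bind-bd b (suc m) = renBound-bd _ (2+ m)
    ... | free c with c ≟ a | c ≟ b
    ...   | yes refl | yes refl = contradiction refl a≢b
    ...   | yes refl | no c≢b rewrite bind-fr≢ c≢b | bind-fr≡ a | bind-bd b 0 = renBound-bd _ 0
    ...   | no c≢a | yes refl rewrite bind-fr≢ c≢a | bind-fr≡ b | bind-bd a 0 = renBound-bd _ 1
    ...   | no c≢a | no c≢b rewrite bind-fr≢ c≢b | bind-fr≢ c≢a | bind-fr≢ c≢b = renBound-fr _ c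

  -- Renumbers from `P ∥ ν a Q` to `ν a (P ∥ Q)`. The binder `a` is the first odd position before
  -- and position 0 after; the names of `P` and the remaining ones of `Q` become even and odd
  -- positions behind it.
  extrude : ℕ ⊎ ℕ → ℕ
  extrude (inj₁ m)       = suc (evens m)
  extrude (inj₂ zero)    = zero
  extrude (inj₂ (suc m)) = suc (odds m)

  extrude-injective : Inj (extrude ∘ split)
  extrude-injective = split-injective ∘ inj _ _
    where
    inj : ∀ c d → extrude c ≡ extrude d → c ≡ d
    inj (inj₁ m)       (inj₁ n)       eq = cong inj₁ (fr-injective (suc-injective eq))
    inj (inj₁ m)       (inj₂ (suc n)) eq = ⊥-elim (fr≢bd (suc-injective eq))
    inj (inj₂ zero)    (inj₂ zero)    eq = refl
    inj (inj₂ (suc m)) (inj₁ n)       eq = ⊥-elim (fr≢bd (sym (suc-injective eq)))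
    inj (inj₂ (suc m)) (inj₂ (suc n)) eq = cong (inj₂ ∘ suc) (bd-injective (suc-injective eq))

  ⟦scope⟧ : ∀ a p q → ¬ fr a ∈sem p →
            ren lft p ⊕ ren rgt (ren (bind a) q) ≋ ren (bind a) (ren lft p ⊕ ren rgt q)
  ⟦scope⟧ a p q a∉p = ≋-trans (≋-ren _ extrude-injective) (≋-reflexive (begin
    ren f (ren lft p ⊕ ren rgt (ren (bind a) q))
      ≡⟨ ren-⊕ f (ren lft p) (ren rgt (ren (bind a) q)) ⟩
    ren f (ren lft p) ⊕ ren f (ren rgt (ren (bind a) q))
      ≡⟨ cong₂ _⊕_ eq₁ eq₂ ⟩
    ren (bind a) (ren lft p) ⊕ ren (bind a) (ren rgt q)
      ≡⟨ ren-⊕ (bind a) (ren lft p) (ren rgt q) ⟨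
    ren (bind a) (ren lft p ⊕ ren rgt q) ∎))
    where
    open ≡-Reasoning
    f = renBound (extrude ∘ split)
    name₁ : ∀ n → n ∈sem p → f (lft n) ≡ bind a (lft n)
    name₁ n n∈ with freeOrBound n
    ... | bound m rewrite renBound-bd evens m | renBound-bd (extrude ∘ split) (evens m) | split-join (inj₁ m) =
      sym (bind-bd a (evens m))
    ... | free c rewrite renBound-fr evens c | renBound-fr (extrude ∘ split) c =
      sym (bind-fr≢ (λ c≡a → a∉p (subst (λ c → fr c ∈sem p) c≡a n∈)))
    name₂ : ∀ n → f (rgt (bind a n)) ≡ bind a (rgt n)
    name₂ n with freeOrBound n
    ... | bound m rewrite bind-bd a m | renBound-bd odds (suc m) | renBound-bd (extrude ∘ split) (odds (suc m))
                        | split-join (inj₂ (suc m)) | renBound-bd odds m = sym (bind-bd a (odds m))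
    ... | free c with c ≟ a
    ...   | yes refl rewrite bind-fr≡ a | renBound-bd odds 0 | renBound-bd (extrude ∘ split) (odds 0)
                           | split-join (inj₂ 0) | renBound-fr odds a = sym (bind-fr≡ a)
    ...   | no c≢a rewrite bind-fr≢ c≢a | renBound-fr odds c | renBound-fr (extrude ∘ split) c = sym (bind-fr≢ c≢a)
    eq₁ : ren f (ren lft p) ≡ ren (bind a) (ren lft p)
    eq₁ = trans (ren-∘ f lft p) (trans (ren-cong p (λ {n} → name₁ n)) (sym (ren-∘ (bind a) lft p)))
    eq₂ : ren f (ren rgt (ren (bind a) q)) ≡ ren (bind a) (ren rgt q)
    eq₂ = trans (cong (ren f) (ren-∘ rgt (bind a) q)) (trans (ren-∘ f _ q)
      (trans (ren-cong q (λ {n} _ → name₂ n)) (sym (ren-∘ (bind a) rgt q))))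

  -- An equality rather than `≋`, because the codes do not record binder names. Freshness of `y`
  -- keeps a free `y` of the body from being bound.
  ⟦α⟧ : ∀ x y (P : Proc S QS) → ¬ (y ∈fn ν x P) → ⟦ ν x P ⟧ ≡ ⟦ ν y (swapP x y P) ⟧
  ⟦α⟧ x y P y∉ = sym (trans (cong (ren (bind y)) (⟦swapP⟧ x y P)) (trans (ren-∘ _ _ ⟦ P ⟧)
    (ren-cong ⟦ P ⟧ (λ {n} → eq n))))
    where
    a≢y : ∀ {a} → a ≢ x → fr a ∈sem ⟦ P ⟧ → a ≢ y
    a≢y a≢x a∈ refl = y∉ (fn-ν a≢x (fr∈⟦⟧⇒∈fn P a∈))
    eq : ∀ n → n ∈sem ⟦ P ⟧ → bind y (renFree (transpose x y) n) ≡ bind x n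
    eq n n∈ with freeOrBound n
    ... | bound m rewrite renFree-bd (transpose x y) m = trans (bind-bd y m) (sym (bind-bd x m))
    ... | free a rewrite renFree-fr (transpose x y) a with a ≟ x
    ...   | yes refl rewrite transpose-left x y = trans (bind-fr≡ y) (sym (bind-fr≡ x))
    ...   | no a≢x rewrite transpose-other {x} {y} a≢x (a≢y a≢x n∈) =
      trans (bind-fr≢ (a≢y a≢x n∈)) (sym (bind-fr≢ a≢x))

  ≡ₚ-sound : {P Q : Proc S QS} → P ≡ₚ Q → ⟦ P ⟧ ≋ ⟦ Q ⟧
  ≡ₚ-sound ≡-refl        = ≋-refl
  ≡ₚ-sound (≡-sym e)     = ≋-sym (≡ₚ-sound e)
  ≡ₚ-sound (≡-trans e f) = ≋-trans (≡ₚ-sound e) (≡ₚ-sound f)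
  ≡ₚ-sound (≡-ν {x} e)   = ≋-bind x (≡ₚ-sound e)
  ≡ₚ-sound (≡-∥ e f)     = ≋-∥ (≡ₚ-sound e) (≡ₚ-sound f)
  ≡ₚ-sound (≡-α {x} {y} {P} y∉) = ≋-reflexive (⟦α⟧ x y P y∉)
  ≡ₚ-sound (≡-assoc {P} {Q} {R}) = ⟦assoc⟧ ⟦ P ⟧ ⟦ Q ⟧ ⟦ R ⟧
  ≡ₚ-sound (≡-comm {P} {Q}) = ⟦comm⟧ ⟦ P ⟧ ⟦ Q ⟧
  ≡ₚ-sound (≡-unit {P})  = ≋-trans (≋-reflexive (⊕-identityʳ (ren lft ⟦ P ⟧))) (≋-sym (≋-ren ⟦ P ⟧ fr-injective))
  ≡ₚ-sound ≡-ν𝟘          = ≋-refl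
  ≡ₚ-sound (≡-νν {a} {b} {P}) = ⟦νν⟧ a b ⟦ P ⟧
  ≡ₚ-sound (≡-scope {a} {P} {Q} a∉) = ⟦scope⟧ a ⟦ P ⟧ ⟦ Q ⟧ (a∉ ∘ fr∈⟦⟧⇒∈fn P)

  ⟦know⟧ : (Γ : List (Msg S)) → ⟦ know {QS = QS} Γ ⟧ ≡ (map (rename fr) Γ ∣ [])
  ⟦know⟧ []      = refl
  ⟦know⟧ (M ∷ Γ) rewrite ⟦know⟧ Γ = cong (_∣ []) (cong₂ _∷_
    (fixed evens M) (trans (map-rename-∘ rgt fr Γ) (map-rename-cong Γ (λ {a} _ → renBound-fr odds a))))
    where
    fixed : ∀ s (M : Msg S) → rename (renBound s) (rename fr M) ≡ rename fr M
    fixed s M = trans (rename-∘ _ fr M) (rename-cong M (λ {a} _ → renBound-fr s a))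

  know-≲ : ∀ {Γ Δ} → _⪯_ I Γ Δ → ⟦ know {QS = QS} Γ ⟧ ≲ ⟦ know Δ ⟧
  know-≲ {Γ} {Δ} Γ⪯Δ rewrite ⟦know⟧ Γ | ⟦know⟧ Δ = id , id ,
    embeds-from-ren {f = fr} {T = Γ ∣ []} ((λ {M} M∈ →
      subst (map (rename fr) Δ ⊢_) (rename-cong M (λ {a} _ → sym (renBound-fr id a)))
        (⊢-ren⇒ fr fr-injective Δ M (Γ⪯Δ M (⊢-∈ I M∈)))) , [] , ↭-refl)

  ≅-sound : {P Q : Proc S QS} → _≅_ I P Q → ⟦ P ⟧ ≋ ⟦ Q ⟧
  ≅-sound (≅-struct e)  = ≡ₚ-sound e
  ≅-sound (≅-know (p , q)) = know-≲ p , know-≲ q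
  ≅-sound (≅-sym e)     = ≋-sym (≅-sound e)
  ≅-sound (≅-trans e f) = ≋-trans (≅-sound e) (≅-sound f)
  ≅-sound (≅-ν {x} e)   = ≋-bind x (≅-sound e)
  ≅-sound (≅-∥ e f)     = ≋-∥ (≅-sound e) (≅-sound f)

-- From standard forms back to processes

module _ {S QS : Signature} where

  runs : List (Call S QS) → Proc S QS
  runs []              = 𝟘
  runs ((q , Ms) ∷ cs) = call q Ms ∥ runs cs

  flat : Sem S QS → Proc S QS
  flat T = know (kn T) ∥ runs (cl T)

  ≡-reflexive : {P Q : Proc S QS} → P ≡ Q → P ≡ₚ Q
  ≡-reflexive refl = ≡-refl

  ≡-unitˡ : {P : Proc S QS} → (𝟘 ∥ P) ≡ₚ P
  ≡-unitˡ = ≡-trans ≡-comm ≡-unit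

  ∥-interchange : {P Q P′ Q′ : Proc S QS} → ((P ∥ Q) ∥ (P′ ∥ Q′)) ≡ₚ ((P ∥ P′) ∥ (Q ∥ Q′))
  ∥-interchange = ≡-trans ≡-assoc (≡-trans
    (≡-∥ ≡-refl (≡-trans (≡-sym ≡-assoc) (≡-trans (≡-∥ ≡-comm ≡-refl) ≡-assoc))) (≡-sym ≡-assoc))

  know-++ : ∀ Γ Δ → know {S} {QS} (Γ ++ Δ) ≡ₚ (know Γ ∥ know Δ)
  know-++ []      Δ = ≡-sym ≡-unitˡ
  know-++ (M ∷ Γ) Δ = ≡-trans (≡-∥ ≡-refl (know-++ Γ Δ)) (≡-sym ≡-assoc)

  runs-++ : ∀ cs ds → runs (cs ++ ds) ≡ₚ (runs cs ∥ runs ds)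
  runs-++ []       ds = ≡-sym ≡-unitˡ
  runs-++ (c ∷ cs) ds = ≡-trans (≡-∥ ≡-refl (runs-++ cs ds)) (≡-sym ≡-assoc)

  runs-↭ : ∀ {cs ds} → cs ↭ ds → runs cs ≡ₚ runs ds
  runs-↭ Perm.refl         = ≡-refl
  runs-↭ (Perm.prep c p)   = ≡-∥ ≡-refl (runs-↭ p)
  runs-↭ (Perm.swap c d p) = ≡-trans (≡-sym ≡-assoc) (≡-trans (≡-∥ ≡-comm (runs-↭ p)) ≡-assoc)
  runs-↭ (Perm.trans p q)  = ≡-trans (runs-↭ p) (runs-↭ q)

  flat-⊕ : ∀ T U → (flat T ∥ flat U) ≡ₚ flat (T ⊕ U)
  flat-⊕ T U = ≡-trans ∥-interchange
    (≡-sym (≡-∥ (know-++ (kn T) (kn U)) (runs-++ (cl T) (cl U))))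

  νs-++ : ∀ xs ys {P : Proc S QS} → νs (xs ++ ys) P ≡ νs xs (νs ys P)
  νs-++ []       ys = refl
  νs-++ (x ∷ xs) ys = cong (ν x) (νs-++ xs ys)

  νs-cong : ∀ xs {P Q : Proc S QS} → P ≡ₚ Q → νs xs P ≡ₚ νs xs Q
  νs-cong []       e = e
  νs-cong (x ∷ xs) e = ≡-ν (νs-cong xs e)

  ∈fn-νs⁻ : ∀ xs {a} {P : Proc S QS} → a ∈fn νs xs P → ¬ (a ∈ xs) × a ∈fn P
  ∈fn-νs⁻ []       p            = (λ ()) , p
  ∈fn-νs⁻ (x ∷ xs) (fn-ν a≢x p) with ∈fn-νs⁻ xs p
  ... | a∉xs , q = (λ { (here a≡x) → a≢x a≡x ; (there a∈xs) → a∉xs a∈xs }) , q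

  ν-unused : ∀ {x} {P : Proc S QS} → ¬ (x ∈fn P) → ν x P ≡ₚ P
  ν-unused x∉P = ≡-trans (≡-ν (≡-sym ≡-unit)) (≡-trans (≡-sym (≡-scope x∉P))
    (≡-trans (≡-∥ ≡-refl ≡-ν𝟘) ≡-unit))

  νs-unused : ∀ xs {P : Proc S QS} → (∀ {x} → x ∈ xs → ¬ (x ∈fn P)) → νs xs P ≡ₚ P
  νs-unused []       _  = ≡-refl
  νs-unused (x ∷ xs) xs∉ = ≡-trans (≡-ν (νs-unused xs (xs∉ ∘ there))) (ν-unused (xs∉ (here refl)))

  νs-scopeʳ : ∀ xs {P Q : Proc S QS} → (∀ {x} → x ∈ xs → ¬ (x ∈fn P)) → (P ∥ νs xs Q) ≡ₚ νs xs (P ∥ Q)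
  νs-scopeʳ []       _   = ≡-refl
  νs-scopeʳ (x ∷ xs) xs∉ = ≡-trans (≡-scope (xs∉ (here refl))) (≡-ν (νs-scopeʳ xs (xs∉ ∘ there)))

  νs-scopeˡ : ∀ xs {P Q : Proc S QS} → (∀ {x} → x ∈ xs → ¬ (x ∈fn Q)) → (νs xs P ∥ Q) ≡ₚ νs xs (P ∥ Q)
  νs-scopeˡ xs xs∉ = ≡-trans ≡-comm (≡-trans (νs-scopeʳ xs xs∉) (νs-cong xs ≡-comm))

  ∈fn-know⁻ : ∀ {a} Γ → a ∈fn know {S} {QS} Γ → a ∈names Γ
  ∈fn-know⁻ (M ∷ Γ) (fn-∥ˡ (fn-msg p)) = here p
  ∈fn-know⁻ (M ∷ Γ) (fn-∥ʳ p)          = there (∈fn-know⁻ Γ p)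

  ∈fn-runs⁻ : ∀ {a} cs → a ∈fn runs cs → a ∈cls cs
  ∈fn-runs⁻ (c ∷ cs) (fn-∥ˡ (fn-call p)) = here p
  ∈fn-runs⁻ (c ∷ cs) (fn-∥ʳ p)           = there (∈fn-runs⁻ cs p)

  ∈fn-flat⁻ : ∀ {a} T → a ∈fn flat T → a ∈sem T
  ∈fn-flat⁻ T (fn-∥ˡ p) = inj₁ (∈fn-know⁻ (kn T) p)
  ∈fn-flat⁻ T (fn-∥ʳ p) = inj₂ (∈fn-runs⁻ (cl T) p)

  swapP-νs : ∀ x y zs (P : Proc S QS) → swapP x y (νs zs P) ≡ νs (map (transpose x y) zs) (swapP x y P)
  swapP-νs x y []       P = refl
  swapP-νs x y (z ∷ zs) P = cong (ν _) (swapP-νs x y zs P)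

  swapP-know : ∀ x y Γ → swapP x y (know {S} {QS} Γ) ≡ know (map (rename (transpose x y)) Γ)
  swapP-know x y []      = refl
  swapP-know x y (M ∷ Γ) = cong (_ ∥_) (swapP-know x y Γ)

  swapP-runs : ∀ x y cs → swapP x y (runs cs) ≡ runs (map (renCall (transpose x y)) cs)
  swapP-runs x y []       = refl
  swapP-runs x y (c ∷ cs) = cong (_ ∥_) (swapP-runs x y cs)

  swapP-flat : ∀ x y T → swapP x y (flat T) ≡ flat (ren (transpose x y) T)
  swapP-flat x y T = cong₂ _∥_ (swapP-know x y (kn T)) (swapP-runs x y (cl T))

  -- The map `d` chooses concrete names. Injectivity keeps the names chosen for binders apart from
  -- one another and from the free names, so every scope can be extruded to the front.
  readback : ∀ P {d} → Inj d → (∀ {a} → a ∈fn P → d (fr a) ≡ a) →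
             P ≡ₚ νs (map d (bn P)) (flat (ren d ⟦ P ⟧))
  readback 𝟘 d-inj d-fr = ≡-sym ≡-unit
  readback ⟪ M ⟫ {d} d-inj d-fr =
    ≡-trans (≡-reflexive (cong ⟪_⟫ (sym M≡))) (≡-sym (≡-trans ≡-unit ≡-unit))
    where
    M≡ : rename d (rename fr M) ≡ M
    M≡ = trans (rename-∘ d fr M) (trans (rename-cong M (d-fr ∘ fn-msg)) (rename-id M))
  readback (call q Ms) {d} d-inj d-fr =
    ≡-trans (≡-reflexive (cong (call q) (sym Ms≡))) (≡-sym (≡-trans ≡-unitˡ ≡-unit))
    where
    Ms≡ : renames d (renames fr Ms) ≡ Ms
    Ms≡ = trans (renames-∘ d fr Ms) (trans (renames-cong Ms (d-fr ∘ fn-call)) (renames-id Ms))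
  readback (P ∥ Q) {d} d-inj d-fr = ≡-trans (≡-∥ readP readQ)
    (≡-trans (νs-scopeˡ xs xs∉) (≡-trans (νs-cong xs (νs-scopeʳ ys ys∉))
      (≡-trans (≡-reflexive (trans (sym (νs-++ xs ys)) (cong (λ zs → νs zs (flat T ∥ flat U)) names≡)))
        (νs-cong zs (≡-trans (flat-⊕ T U) (≡-reflexive (cong flat sem≡)))))))
    where
    xs = map (d ∘ lft) (bn P)
    ys = map (d ∘ rgt) (bn Q)
    zs = map d (map lft (bn P) ++ map rgt (bn Q))
    T = ren (d ∘ lft) ⟦ P ⟧
    U = ren (d ∘ rgt) ⟦ Q ⟧
    readP : P ≡ₚ νs xs (flat T)
    readP = readback P (lft-injective ∘ d-inj) (λ {a} a∈ → trans (cong d (renBound-fr evens a)) (d-fr (fn-∥ˡ a∈)))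
    readQ : Q ≡ₚ νs ys (flat U)
    readQ = readback Q (rgt-injective ∘ d-inj) (λ {a} a∈ → trans (cong d (renBound-fr odds a)) (d-fr (fn-∥ʳ a∈)))
    names≡ : xs ++ ys ≡ zs
    names≡ = sym (trans (map-++ d (map lft (bn P)) _) (cong₂ _++_ (sym (map-∘ (bn P))) (sym (map-∘ (bn Q)))))
    sem≡ : T ⊕ U ≡ ren d ⟦ P ∥ Q ⟧
    sem≡ = sym (trans (ren-⊕ d (ren lft ⟦ P ⟧) _) (cong₂ _⊕_ (ren-∘ d lft ⟦ P ⟧) (ren-∘ d rgt ⟦ Q ⟧)))
    apart : ∀ {s t} (R : Sem S QS) → (∀ {m m′} → s m ≢ t m′) → ∀ {m n} → n ∈sem R →
            d (renBound s (bd m)) ≢ d (renBound t n)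
    apart {s} {t} R s≢t {m} {n} n∈ eq with freeOrBound n
    ... | free a  = fr≢bd (sym (trans (sym (renBound-bd s m)) (trans (d-inj eq) (renBound-fr t a))))
    ... | bound k = s≢t (bd-injective (trans (sym (renBound-bd s m)) (trans (d-inj eq) (renBound-bd t k))))
    xs∉ : ∀ {x} → x ∈ xs → ¬ (x ∈fn νs ys (flat U))
    xs∉ x∈ x∈fn with ∈-map⁻ (d ∘ lft) x∈ | ∈sem-ren⁻ (d ∘ rgt) ⟦ Q ⟧ (∈fn-flat⁻ U (proj₂ (∈fn-νs⁻ ys x∈fn)))
    ... | b , b∈ , refl | n , n∈ , eq with bn-bound P b∈
    ...   | m , refl = apart ⟦ Q ⟧ fr≢bd n∈ eq
    ys∉ : ∀ {y} → y ∈ ys → ¬ (y ∈fn flat T)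
    ys∉ y∈ y∈fn with ∈-map⁻ (d ∘ rgt) y∈ | ∈sem-ren⁻ (d ∘ lft) ⟦ P ⟧ (∈fn-flat⁻ T y∈fn)
    ... | b , b∈ , refl | n , n∈ , eq with bn-bound Q b∈
    ...   | m , refl = apart ⟦ P ⟧ (fr≢bd ∘ sym) n∈ eq
  readback (ν x P) {d} d-inj d-fr = ≡-trans (≡-ν readP) (≡-trans (≡-α y∉) (≡-ν (≡-reflexive after)))
    where
    open ≡-Reasoning
    y = d (bd 0)
    t = transpose x y
    -- The body still contains `x`, whereas `d ∘ bind x` would call it `y`. Composing with the swap
    -- makes `d′` return `x` to itself, as the induction hypothesis requires; the later α-conversion
    -- from `x` to `y` swaps once more and cancels `t`.
    d′ = t ∘ d ∘ bind x
    d-fr′ : ∀ {a} → a ∈fn P → d′ (fr a) ≡ a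
    d-fr′ {a} a∈ with a ≟ x
    ... | yes refl = trans (cong (t ∘ d) (bind-fr≡ x)) (transpose-right x y)
    ... | no a≢x   = trans (cong (t ∘ d) (bind-fr≢ a≢x)) (trans (cong t da≡a) (transpose-other a≢x a≢y))
      where
      da≡a = d-fr (fn-ν a≢x a∈)
      a≢y : a ≢ y
      a≢y a≡y = fr≢bd (d-inj (trans da≡a a≡y))
    readP : P ≡ₚ νs (map d′ (bn P)) (flat (ren d′ ⟦ P ⟧))
    readP = readback P (bind-injective x ∘ d-inj ∘ transpose-injective x y) d-fr′
    y∉ : ¬ (y ∈fn ν x (νs (map d′ (bn P)) (flat (ren d′ ⟦ P ⟧))))
    y∉ (fn-ν y≢x p) with ∈fn-νs⁻ (map d′ (bn P)) p
    ... | y∉bn , q with ∈sem-ren⁻ d′ ⟦ P ⟧ (∈fn-flat⁻ _ q)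
    ...   | n , n∈ , y≡ with origin P n∈
    ...     | bound n∈bn = y∉bn (subst (_∈ map d′ (bn P)) (sym y≡) (∈-map⁺ d′ n∈bn))
    ...     | free {a} a∈ = fr≢bd (d-inj (trans (d-fr (fn-ν (λ a≡x → y≢x (trans y≡a a≡x)) a∈)) (sym y≡a)))
      where
      y≡a : y ≡ a
      y≡a = trans y≡ (d-fr′ a∈)
    cancel : ∀ n → t (d′ n) ≡ d (bind x n)
    cancel n = transpose-involutive x y _
    after : swapP x y (νs (map d′ (bn P)) (flat (ren d′ ⟦ P ⟧))) ≡
            νs (map d (map (bind x) (bn P))) (flat (ren d (ren (bind x) ⟦ P ⟧)))
    after = begin
      swapP x y (νs (map d′ (bn P)) (flat (ren d′ ⟦ P ⟧)))
        ≡⟨ swapP-νs x y (map d′ (bn P)) _ ⟩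
      νs (map t (map d′ (bn P))) (swapP x y (flat (ren d′ ⟦ P ⟧)))
        ≡⟨ cong (νs _) (swapP-flat x y (ren d′ ⟦ P ⟧)) ⟩
      νs (map t (map d′ (bn P))) (flat (ren t (ren d′ ⟦ P ⟧)))
        ≡⟨ cong₂ (λ zs T → νs zs (flat T))
             (trans (sym (map-∘ (bn P))) (trans (map-cong-local (All.tabulate λ {n} _ → cancel n)) (map-∘ (bn P))))
             (trans (ren-∘ t d′ ⟦ P ⟧) (trans (ren-cong ⟦ P ⟧ (λ {n} _ → cancel n)) (sym (ren-∘ d (bind x) ⟦ P ⟧)))) ⟩
      νs (map d (map (bind x) (bn P))) (flat (ren d (ren (bind x) ⟦ P ⟧))) ∎

module _ (b : ℕ) where

  decodeSum : ℕ ⊎ ℕ → ℕ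
  decodeSum (inj₁ a) with a <? b
  ... | yes _ = a
  ... | no _  = b + fr a
  decodeSum (inj₂ m) = b + bd m

  decode : Name → Name
  decode = decodeSum ∘ split

  decode-fr : ∀ {a} → a < b → decode (fr a) ≡ a
  decode-fr {a} a<b rewrite split-join (inj₁ a) with a <? b
  ... | yes _   = refl
  ... | no a≮b = contradiction a<b a≮b

  decode-injective : Inj decode
  decode-injective = split-injective ∘ inj _ _
    where
    inj : ∀ c d → decodeSum c ≡ decodeSum d → c ≡ d
    inj (inj₁ a) (inj₁ a′) eq with a <? b | a′ <? b
    ... | yes _   | yes _    = cong inj₁ eq
    ... | yes a<b | no _     = contradiction a<b (≤⇒≯ (subst (b ≤_) (sym eq) (m≤m+n b _)))
    ... | no _    | yes a′<b = contradiction a′<b (≤⇒≯ (subst (b ≤_) eq (m≤m+n b _)))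
    ... | no _    | no _     = cong inj₁ (fr-injective (+-cancelˡ-≡ b _ _ eq))
    inj (inj₁ a) (inj₂ m) eq with a <? b
    ... | yes a<b = contradiction a<b (≤⇒≯ (subst (b ≤_) (sym eq) (m≤m+n b _)))
    ... | no _    = ⊥-elim (fr≢bd (+-cancelˡ-≡ b _ _ eq))
    inj (inj₂ m) (inj₁ a) eq with a <? b
    ... | yes a<b = contradiction a<b (≤⇒≯ (subst (b ≤_) eq (m≤m+n b _)))
    ... | no _    = ⊥-elim (fr≢bd (sym (+-cancelˡ-≡ b _ _ eq)))
    inj (inj₂ m) (inj₂ n) eq = cong inj₂ (bd-injective (+-cancelˡ-≡ b _ _ eq))

module _ {S QS : Signature} (I : IntruderModel S) where
  open IntruderModel I

  -- Reading `P` back along `d ∘ renBound f` and `P′` along `d` makes the calls of `P` occur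
  -- literally among those of `P′`. They form the common part `Q` in the definition of `⊑`.
  ≲⇒⊑ : ∀ {b} (P P′ : Proc S QS) → (∀ {a} → a ∈fn P → a < b) → (∀ {a} → a ∈fn P′ → a < b) →
        _≲_ I ⟦ P ⟧ ⟦ P′ ⟧ → _⊑_ I P P′
  ≲⇒⊑ {b} P P′ fnP fnP′ (f , f-inj , (knows , (cs , cl↭))) =
    xs , ys , kn T , kn U , runs (cl T) , runs (map (renCall d) cs) ,
    readback P (renBound-injective f-inj ∘ d-inj) (λ {a} a∈ → trans (cong d (renBound-fr f a)) (decode-fr b (fnP a∈))) ,
    -- The prefix `ys` already binds every bound name of `flat U`, so the prefix `xs` demanded by
    -- `⊑` can be put in front as vacuous binders, even where the two lists overlap.
    ≡-trans (readback P′ d-inj (decode-fr b ∘ fnP′)) (≡-trans (≡-sym (νs-unused xs xs∉))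
      (νs-cong xs (νs-cong ys flatU))) ,
    λ M → ⊢-cut* I derive
    where
    d = decode b
    d-inj = decode-injective b
    g = d ∘ renBound f
    xs = map g (bn P)
    ys = map d (bn P′)
    T = ren g ⟦ P ⟧
    U = ren d ⟦ P′ ⟧
    flatU : flat U ≡ₚ ((know (kn U) ∥ runs (cl T)) ∥ runs (map (renCall d) cs))
    flatU = ≡-trans (≡-∥ ≡-refl (≡-trans (runs-↭ clU↭) (runs-++ (cl T) _))) (≡-sym ≡-assoc)
      where
      clU↭ : cl U ↭ cl T ++ map (renCall d) cs
      clU↭ = ↭-trans (↭ₚ.map⁺ (renCall d) cl↭) (↭-reflexive (trans (map-++ (renCall d) _ cs)
        (cong (_++ map (renCall d) cs) (map-renCall-∘ d (renBound f) (cl ⟦ P ⟧)))))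
    xs∉ : ∀ {x} → x ∈ xs → ¬ (x ∈fn νs ys (flat U))
    xs∉ x∈ x∈fn with ∈fn-νs⁻ ys x∈fn
    ... | x∉ys , p with ∈-map⁻ g x∈ | ∈sem-ren⁻ d ⟦ P′ ⟧ (∈fn-flat⁻ U p)
    ...   | c , c∈ , refl | n , n∈ , eq with origin P′ n∈ | bn-bound P c∈
    ...     | bound n∈bn | _        = x∉ys (subst (_∈ ys) (sym eq) (∈-map⁺ d n∈bn))
    ...     | free a∈    | m , refl = fr≢bd (sym (trans (sym (renBound-bd f m)) (d-inj eq)))
    derive : ∀ {M} → M ∈ kn T → kn U ⊢ M
    derive M∈ with ∈-map⁻ (rename g) M∈
    ... | N , N∈ , refl = subst (kn U ⊢_) (rename-∘ d (renBound f) N)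
      (⊢-ren⇒ d d-inj (kn ⟦ P′ ⟧) (rename (renBound f) N) (knows N∈))

-- Finitely many messages of bounded size over finitely many names

≤max : ∀ {x xs} → x ∈ xs → x ≤ max 0 xs
≤max x∈xs = All.lookup (xs≤max 0 _) x∈xs

vecs : {A : Set} → List A → ∀ n → List (Vec A n)
vecs L zero    = [] ∷ []
vecs L (suc n) = cartesianProductWith _∷_ L (vecs L n)

∈-applications : ∀ (QS : Signature) {A B : Set} (L : List A) (g : ∀ q → Vec A (arity QS q) → B) q {xs} →
                 xs ∈ vecs L (arity QS q) →
                 g q xs ∈ concatMap (λ q → map (g q) (vecs L (arity QS q))) (allFin (nsym QS))
∈-applications QS L g q xs∈ = ∈-concat⁺′ (∈-map⁺ (g q) xs∈) (∈-map⁺ _ (∈-allFin q))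

module _ {S : Signature} where

  msgs : ℕ → ℕ → List (Msg S)
  msgs n zero    = []
  msgs n (suc s) = map name (upTo n) ++
    concatMap (λ f → map (app f) (vecs (msgs n s) (arity S f))) (allFin (nsym S))

  mutual
    ∈-msgs : ∀ {n} s M → size M ≤ s → (∀ {a} → a ∈nm M → a < n) → M ∈ msgs n s
    ∈-msgs (suc s) (name a)   (s≤s _)  small = ∈-++⁺ˡ (∈-map⁺ name (∈-upTo⁺ (small nm-name)))
    ∈-msgs {n} (suc s) (app f Ms) (s≤s sz) small =
      ∈-++⁺ʳ (map name (upTo n)) (∈-applications S (msgs n s) app f (∈-vecs s Ms sz (small ∘ nm-app)))

    ∈-vecs : ∀ {n} s {m} (Ms : Vec (Msg S) m) → sizes Ms ≤ s → (∀ {a} → a ∈nms Ms → a < n) →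
             Ms ∈ vecs (msgs n s) m
    ∈-vecs s []       sz small = here refl
    ∈-vecs s (M ∷ Ms) sz small = ∈-cartesianProductWith⁺ _∷_
      (∈-msgs s M (m⊔n≤o⇒m≤o (size M) (sizes Ms) sz) (small ∘ nms-here))
      (∈-vecs s Ms (m⊔n≤o⇒n≤o (size M) (sizes Ms) sz) (small ∘ nms-there))

  -- Bounds the number of name occurrences in a message of size at most `s`: each level multiplies
  -- by the largest arity, and `suc` covers the case of a single name.
  width : ℕ → ℕ
  width zero    = 0
  width (suc s) = suc (max 0 (map (arity S) (allFin (nsym S))) * width s)

  mutual
    length-namesOf : ∀ s (M : Msg S) → size M ≤ s → length (namesOf M) ≤ width s
    length-namesOf (suc s) (name a)   _        = s≤s z≤n
    length-namesOf (suc s) (app f Ms) (s≤s sz) = m≤n⇒m≤1+n (≤-trans (length-namesOfs s Ms sz)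
      (*-monoˡ-≤ (width s) (≤max (∈-map⁺ (arity S) (∈-allFin f)))))

    length-namesOfs : ∀ s {m} (Ms : Vec (Msg S) m) → sizes Ms ≤ s → length (namesOfs Ms) ≤ m * width s
    length-namesOfs s []       sz = z≤n
    length-namesOfs s (M ∷ Ms) sz = ≤-trans (≤-reflexive (length-++ (namesOf M)))
      (+-mono-≤ (length-namesOf s M (m⊔n≤o⇒m≤o (size M) (sizes Ms) sz))
                (length-namesOfs s Ms (m⊔n≤o⇒n≤o (size M) (sizes Ms) sz)))

∈-pointwise : {A B : Set} {R : A → B → Set} → ∀ {x xs ys} → Pointwise R xs ys → x ∈ xs → ∃[ y ] y ∈ ys × R x y
∈-pointwise (r ∷ rs) (here refl) = _ , here refl , r
∈-pointwise (r ∷ rs) (there x∈) with ∈-pointwise rs x∈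
... | y , y∈ , r′ = y , there y∈ , r′

update : (Name → Name) → Name → Name → Name → Name
update f x y a with a ≟ x
... | yes _ = y
... | no _  = f a

update-≡ : ∀ f x y → update f x y x ≡ y
update-≡ f x y with x ≟ x
... | yes _  = refl
... | no x≢x = contradiction refl x≢x

update-≢ : ∀ f {x} y {a} → a ≢ x → update f x y a ≡ f a
update-≢ f {x} y {a} a≢x with a ≟ x
... | yes a≡x = contradiction a≡x a≢x
... | no _    = refl

-- Canonical processes

module _ (b k : ℕ) where

  -- Clears the `k` names from `b` on, one for the binders of each nesting level.
  shift : Name → Name
  shift a with a <? b
  ... | yes _ = a
  ... | no _  = k + a

  shift-< : ∀ {a} → a < b → shift a ≡ a
  shift-< {a} a<b with a <? b
  ... | yes _  = refl
  ... | no a≮b = contradiction a<b a≮b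

  shift-injective : Inj shift
  shift-injective {a} {c} eq with a <? b | c <? b
  ... | yes _   | yes _   = eq
  ... | yes a<b | no c≮b  = contradiction (subst (_< b) eq a<b) (≤⇒≯ (≤-trans (≮⇒≥ c≮b) (m≤n+m c k)))
  ... | no a≮b  | yes c<b = contradiction (subst (_< b) (sym eq) c<b) (≤⇒≯ (≤-trans (≮⇒≥ a≮b) (m≤n+m a k)))
  ... | no _    | no _    = +-cancelˡ-≡ k _ _ eq

  shift-gap : ∀ a → shift a < b + 0 ⊎ b + k ≤ shift a
  shift-gap a with a <? b
  ... | yes a<b = inj₁ (subst (a <_) (sym (+-identityʳ b)) a<b)
  ... | no a≮b  = inj₂ (subst (b + k ≤_) (+-comm a k) (+-monoˡ-≤ k (≮⇒≥ a≮b)))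

  -- The renamings to which a single message may be subjected: the names below `b` and the binder
  -- names stay, and only surplus free names move.
  Fixes : (Name → Name) → Set
  Fixes g = Inj g × (∀ {a} → a < b + k → g a ≡ a)

  id-fixes : Fixes id
  id-fixes = id , λ _ → refl

Closed : ∀ {S QS} → ℕ → Sem S QS → Set
Closed b T = ∀ {a} → fr a ∈sem T → a < b

module _ {S QS : Signature} (I : IntruderModel S) (b k s : ℕ) where
  open IntruderModel I

  -- Names below `F` have a common meaning in all messages. One message contains at most `width s`
  -- others, so `N` names suffice for each message on its own.
  F N : ℕ
  F = b + k
  N = F + width {S} s

  leaves : List (Proc S QS)
  leaves = map ⟪_⟫ (msgs N s) ++
    concatMap (λ q → map (call q) (vecs (msgs N s) (arity QS q))) (allFin (nsym QS))

  ⟪⟫∈leaves : ∀ M → size M ≤ s → (∀ {a} → a ∈nm M → a < N) → ⟪ M ⟫ ∈ leaves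
  ⟪⟫∈leaves M sz small = ∈-++⁺ˡ (∈-map⁺ ⟪_⟫ (∈-msgs s M sz small))

  call∈leaves : ∀ q Ms → sizes Ms ≤ s → (∀ {a} → a ∈nms Ms → a < N) → call q Ms ∈ leaves
  call∈leaves q Ms sz small =
    ∈-++⁺ʳ (map ⟪_⟫ (msgs N s)) (∈-applications QS (msgs N s) call q (∈-vecs s Ms sz small))

  Forest : ℕ → Set
  Forest = Tree (suc (length leaves))

  -- Label zero stands for every binder, whose name is determined by its level. A leaf label carries
  -- a dummy subforest, which is ignored.
  proc : ∀ {j} → ℕ → Forest j → Proc S QS
  proc {zero}  l t                       = 𝟘
  proc {suc j} l []                      = 𝟘
  proc {suc j} l ((Fin.zero , t) ∷ ts)  = ν (b + l) (proc (suc l) t) ∥ proc l ts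
  proc {suc j} l ((Fin.suc i , _) ∷ ts) = lookup leaves i ∥ proc l ts

  ≼⇒≲ : ∀ {j} l {t u : Forest j} → _≼_ {j = j} t u → _≲_ I ⟦ proc l t ⟧ ⟦ proc l u ⟧
  ≼⇒≲ {zero}  l tt         = ≲-refl I
  ≼⇒≲ {suc j} l []         = ≲-refl I
  ≼⇒≲ {suc j} l ((Fin.zero , u) ∷ʳ e)             = ≲-weakenˡ I (≼⇒≲ {suc j} l e)
  ≼⇒≲ {suc j} l ((Fin.suc i , u) ∷ʳ e)            = ≲-weakenˡ I (≼⇒≲ {suc j} l e)
  ≼⇒≲ {suc j} l {(Fin.zero , t) ∷ _} ((refl , d) ∷ e)  =
    ≲-∥ I (≲-bind I (b + l) (≼⇒≲ {j} (suc l) d)) (≼⇒≲ {suc j} l e)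
  ≼⇒≲ {suc j} l {(Fin.suc i , t) ∷ _} ((refl , d) ∷ e) = ≲-∥ I (≲-refl I) (≼⇒≲ {suc j} l e)

  proc-++ : ∀ {j} l (t u : Forest (suc j)) → proc l (t ++ u) ≡ₚ (proc l t ∥ proc l u)
  proc-++ l []                     u = ≡-sym ≡-unitˡ
  proc-++ l ((Fin.zero , _) ∷ t)  u = ≡-trans (≡-∥ ≡-refl (proc-++ l t u)) (≡-sym ≡-assoc)
  proc-++ l ((Fin.suc _ , _) ∷ t) u = ≡-trans (≡-∥ ≡-refl (proc-++ l t u)) (≡-sym ≡-assoc)

  emptyForest : ∀ j → Forest j
  emptyForest zero    = tt
  emptyForest (suc j) = []

  leafForest : ∀ {V} j l → V ∈ leaves → ∃[ t ] V ≡ₚ proc {suc j} l t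
  leafForest {V} j l V∈ = (Fin.suc (Any.index V∈) , emptyForest j) ∷ [] ,
    ≡-trans (≡-reflexive (Anyₚ.lookup-index V∈)) (≡-sym ≡-unit)

  Tracks : (Name → Name) → Msg S → Msg S → Set
  Tracks r M M′ = ∃[ g ] Fixes b k g × M′ ≡ rename (renFree (g ∘ r)) M

  -- Known messages follow `r` only up to a renaming of their own, whereas calls follow `r` exactly.
  -- The height is `suc j` because leaves lie one level below the innermost of `j` nested binders.
  record Canonical (r : Name → Name) (l j : ℕ) (Q : Proc S QS) : Set where
    field
      can    : Proc S QS
      forest : Forest (suc j)
      can≡   : can ≡ₚ proc l forest
      tracks : Pointwise (Tracks r) (kn ⟦ Q ⟧) (kn ⟦ can ⟧)
      cl≡    : cl ⟦ can ⟧ ≡ map (renCall (renFree r)) (cl ⟦ Q ⟧)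
  open Canonical

  tracks-map : ∀ {r r′ h h′ Γ Δ} → (∀ {g} → Fixes b k g → ∀ n → h′ (renFree (g ∘ r) n) ≡ renFree (g ∘ r′) (h n)) →
               Pointwise (Tracks r) Γ Δ → Pointwise (Tracks r′) (map (rename h) Γ) (map (rename h′) Δ)
  tracks-map {r} {r′} {h} {h′} comm ps = Pointwise.map⁺ (rename h) (rename h′) (Pointwise.map
    (λ { {M} (g , fixes , refl) → g , fixes ,
         trans (rename-∘ h′ _ M) (trans (rename-cong M (λ {n} _ → comm fixes n)) (sym (rename-∘ _ h M))) }) ps)

  cl-map : ∀ {r r′ h h′} (cs : List (Call S QS)) → (∀ n → h′ (renFree r n) ≡ renFree r′ (h n)) →
           map (renCall h′) (map (renCall (renFree r)) cs) ≡ map (renCall (renFree r′)) (map (renCall h) cs)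
  cl-map {r} {r′} {h} {h′} cs comm = trans (map-renCall-∘ h′ _ cs)
    (trans (map-renCall-cong cs (λ {n} _ → comm n)) (sym (map-renCall-∘ _ h cs)))

  -- The hypothesis on all `r a` says that `r` avoids the names from `b + l` up to `F`, reserved for
  -- the binders still to come, and `l + j ≡ k` that there are enough of them. The last hypothesis
  -- bounds names in calls only, since known messages may contain surplus names of any size.
  canonical : ∀ Q r l j → l + j ≡ k → nest Q ≤ j → InSize s Q →
              (∀ a → r a < b + l ⊎ F ≤ r a) → (∀ {a} → fr a ∈cls cl ⟦ Q ⟧ → r a < F) →
              Canonical r l j Q
  canonical 𝟘 r l j l+j≡k nest≤ insize gap small =
    record { can = 𝟘 ; forest = [] ; can≡ = ≡-refl ; tracks = [] ; cl≡ = refl }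
  canonical (ν x Q) r l (suc j) l+j≡k (s≤s nest≤) insize gap small = record
    { can    = ν (b + l) (can C)
    ; forest = (Fin.zero , forest C) ∷ []
    ; can≡   = ≡-trans (≡-ν (can≡ C)) (≡-sym ≡-unit)
    ; tracks = tracks-map commute (tracks C)
    ; cl≡    = trans (cong (map (renCall (bind (b + l)))) (cl≡ C)) (cl-map (cl ⟦ Q ⟧) (commute (id-fixes b k)))
    }
    where
    l<k : l < k
    l<k = ≤-trans (s≤s (m≤m+n l j)) (≤-reflexive (trans (sym (+-suc l j)) l+j≡k))
    -- Parallel binders of one level share this name, which is harmless because their scopes are
    -- disjoint; `gap` keeps it apart from enclosing binders and free names.
    r′ = update r x (b + l)
    gap′ : ∀ a → r′ a < b + suc l ⊎ F ≤ r′ a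
    gap′ a with a ≟ x
    ... | yes _ = inj₁ (+-monoʳ-< b (n<1+n l))
    ... | no _  = map₁ (λ lt → <-trans lt (+-monoʳ-< b (n<1+n l))) (gap a)
    small′ : ∀ {a} → fr a ∈cls cl ⟦ Q ⟧ → r′ a < F
    small′ {a} a∈ with a ≟ x
    ... | yes _  = +-monoʳ-< b l<k
    ... | no a≢x = small (subst (_∈cls cl ⟦ ν x Q ⟧) (bind-fr≢ a≢x) (∈cls-ren⁺ (bind x) a∈))
    C : Canonical r′ (suc l) j Q
    C = canonical Q r′ (suc l) j (trans (sym (+-suc l j)) l+j≡k) nest≤ (λ M → insize M ∘ msg-ν) gap′ small′
    commute : ∀ {g} → Fixes b k g → ∀ n → bind (b + l) (renFree (g ∘ r′) n) ≡ renFree (g ∘ r) (bind x n)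
    commute {g} (g-inj , fix) = bind-renFree (trans (cong g (update-≡ r x (b + l))) (fix (+-monoʳ-< b l<k)))
      (λ a a≢x → cong g (update-≢ r (b + l) a≢x) , λ gra≡ → avoid a (g-inj (trans gra≡ (sym (fix (+-monoʳ-< b l<k))))))
      where
      avoid : ∀ a → r a ≢ b + l
      avoid a eq with gap a
      ... | inj₁ lt = <⇒≢ lt eq
      ... | inj₂ ge = <⇒≱ (+-monoʳ-< b l<k) (subst (F ≤_) eq ge)
  canonical (P ∥ Q) r l j l+j≡k nest≤ insize gap small = record
    { can    = can C ∥ can D
    ; forest = forest C ++ forest D
    ; can≡   = ≡-trans (≡-∥ (can≡ C) (can≡ D)) (≡-sym (proc-++ l (forest C) (forest D)))
    ; tracks = Pointwise.++⁺ (tracks-map (λ {g} _ n → sym (renFree-renBound (g ∘ r) evens n)) (tracks C))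
                             (tracks-map (λ {g} _ n → sym (renFree-renBound (g ∘ r) odds n)) (tracks D))
    ; cl≡    = trans (cong₂ _++_ (side evens (cl≡ C)) (side odds (cl≡ D)))
                     (sym (map-++ (renCall (renFree r)) (map (renCall lft) (cl ⟦ P ⟧)) _))
    }
    where
    side : ∀ h {cs ds : List (Call S QS)} → cs ≡ map (renCall (renFree r)) ds →
           map (renCall (renBound h)) cs ≡ map (renCall (renFree r)) (map (renCall (renBound h)) ds)
    side h {ds = ds} refl = cl-map ds (λ n → sym (renFree-renBound r h n))
    C : Canonical r l j P
    C = canonical P r l j l+j≡k (m⊔n≤o⇒m≤o _ _ nest≤) (λ M → insize M ∘ msg-∥ˡ) gap
      (λ {a} a∈ → small (Anyₚ.++⁺ˡ (subst (_∈cls map (renCall lft) (cl ⟦ P ⟧)) (renBound-fr evens a) (∈cls-ren⁺ lft a∈))))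
    D : Canonical r l j Q
    D = canonical Q r l j l+j≡k (m⊔n≤o⇒n≤o _ _ nest≤) (λ M → insize M ∘ msg-∥ʳ) gap
      (λ {a} a∈ → small (Anyₚ.++⁺ʳ (map (renCall lft) (cl ⟦ P ⟧))
        (subst (_∈cls map (renCall rgt) (cl ⟦ Q ⟧)) (renBound-fr odds a) (∈cls-ren⁺ rgt a∈))))
  canonical ⟪ M ⟫ r l j l+j≡k nest≤ insize gap small
    -- Here the message gets its private renaming. Compressing from `F` on leaves the names below
    -- `b` and the level names alone.
    with compress F (namesOf (rename r M))
  ... | g , g-inj , fix , low = record
    { can    = ⟪ M′ ⟫
    ; forest = proj₁ leaf
    ; can≡   = proj₂ leaf
    ; tracks = (g , (g-inj , fix) , M′≡) ∷ []
    ; cl≡    = refl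
    }
    where
    M′ = rename g (rename r M)
    sz : size M ≤ s
    sz = insize M msg-out
    low′ : ∀ {a} → a ∈nm M′ → a < N
    low′ a∈ with ∈nm-rename⁻ g (rename r M) a∈
    ... | c , c∈ , refl = <-≤-trans (low (∈-namesOf c∈))
      (+-monoʳ-≤ F (length-namesOf s (rename r M) (subst (_≤ s) (sym (size-rename r M)) sz)))
    leaf = leafForest j l (⟪⟫∈leaves M′ (subst (_≤ s) (sym (trans (size-rename g (rename r M)) (size-rename r M))) sz) low′)
    M′≡ : rename fr M′ ≡ rename (renFree (g ∘ r)) (rename fr M)
    M′≡ = trans (trans (cong (rename fr) (rename-∘ g r M)) (rename-∘ fr _ M))
      (trans (rename-cong M (λ {a} _ → sym (renFree-fr (g ∘ r) a))) (sym (rename-∘ _ fr M)))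
  canonical (call q Ms) r l j l+j≡k nest≤ insize gap small = record
    { can    = call q (renames r Ms)
    ; forest = proj₁ leaf
    ; can≡   = proj₂ leaf
    ; tracks = []
    ; cl≡    = cong (λ Ns → (q , Ns) ∷ []) (trans (renames-∘ fr r Ms)
        (trans (renames-cong Ms (λ {a} _ → sym (renFree-fr r a))) (sym (renames-∘ _ fr Ms))))
    }
    where
    bounded : ∀ {n} (Ns : Vec (Msg S) n) → (∀ M → _∈msgV_ {S} {QS} M Ns → size M ≤ s) → sizes Ns ≤ s
    bounded []       h = z≤n
    bounded (M ∷ Ns) h = ⊔-lub (h M mv-here) (bounded Ns (λ M → h M ∘ mv-there))
    low : ∀ {a} → a ∈nms renames r Ms → a < N
    low a∈ with ∈nms-renames⁻ r Ms a∈
    ... | c , c∈ , refl = <-≤-trans (small (here (∈nms-renames⁺ fr c∈))) (m≤m+n F _)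
    leaf = leafForest j l (call∈leaves q (renames r Ms)
      (subst (_≤ s) (sym (sizes-renames r Ms)) (bounded Ms (λ M → insize M ∘ msg-call))) low)

  ren-closed : ∀ {g} (T : Sem S QS) → Closed b T → Fixes b k g → ren (renFree (g ∘ (shift b k))) T ≡ T
  ren-closed {g} T closed (_ , fix) = trans (ren-cong T (λ {n} → same n)) (ren-id T)
    where
    same : ∀ n → n ∈sem T → renFree (g ∘ (shift b k)) n ≡ n
    same n n∈ with freeOrBound n
    ... | bound m = renFree-bd _ m
    ... | free a  = trans (renFree-fr _ a) (cong fr (trans (cong g (shift-< b k a<b)) (fix (<-≤-trans a<b (m≤m+n b k)))))
      where a<b = closed n∈

  -- The renaming g depends on the message, but it always fixes the names of T.
  canonical-≲ : ∀ {Q l j} T → Closed b T → (C : Canonical (shift b k) l j Q) →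
                _≲_ I ⟦ Q ⟧ T → _≲_ I ⟦ can C ⟧ T
  canonical-≲ {Q} T closed C (f , f-inj , (knows , (cs , cl↭))) = f , f-inj , (knows′ , (_ , calls′))
    where
    r = renFree (shift b k)
    knows′ : ∀ {M} → M ∈ kn ⟦ can C ⟧ → kn T ⊢ rename (renBound f) M
    knows′ M∈ with ∈-pointwise (Pointwise.symmetric id (tracks C)) M∈
    ... | M , M∈Q , g , fixes , refl = subst₂ _⊢_ (cong kn (ren-closed T closed fixes))
      (trans (rename-∘ _ _ M) (trans (rename-cong M (λ {n} _ → renFree-renBound (g ∘ (shift b k)) f n)) (sym (rename-∘ _ _ M))))
      (⊢-ren⇒ _ (renFree-injective (shift-injective b k ∘ proj₁ fixes)) (kn T) _ (knows M∈Q))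
    calls′ : cl T ↭ map (renCall (renBound f)) (cl ⟦ can C ⟧) ++ map (renCall r) cs
    calls′ = ↭-trans (↭-reflexive (sym (cong cl (ren-closed T closed (id-fixes b k))))) (↭-trans (↭ₚ.map⁺ (renCall r) cl↭)
      (↭-reflexive (trans (map-++ (renCall r) _ cs) (cong (_++ map (renCall r) cs) (trans
        (sym (cl-map (cl ⟦ Q ⟧) (λ n → sym (renFree-renBound (shift b k) f n)))) (cong (map _) (sym (cl≡ C))))))))

  -- Now the renaming is undone by `⊢-ren⇐`. The calls agree literally, since `shift` fixes names
  -- below `b`.
  ≲-canonical : ∀ {Q l j} T → Closed b T → (C : Canonical (shift b k) l j Q) →
                (∀ {a} → fr a ∈cls cl ⟦ Q ⟧ → a < b) → _≲_ I ⟦ can C ⟧ T → _≲_ I ⟦ Q ⟧ T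
  ≲-canonical {Q} T closed C small (f , f-inj , (knows , (cs , cl↭))) =
    f , f-inj , (knows′ , (cs , subst (λ ds → cl T ↭ map (renCall (renBound f)) ds ++ cs) cl-can cl↭))
    where
    knows′ : ∀ {M} → M ∈ kn ⟦ Q ⟧ → kn T ⊢ rename (renBound f) M
    knows′ {M} M∈ with ∈-pointwise (tracks C) M∈
    ... | _ , M′∈ , g , fixes , refl =
      ⊢-ren⇐ _ (renFree-injective (shift-injective b k ∘ proj₁ fixes)) (kn T) _
        (subst₂ _⊢_ (sym (cong kn (ren-closed T closed fixes)))
          (trans (rename-∘ _ _ M) (trans (rename-cong M (λ {n} _ → sym (renFree-renBound (g ∘ (shift b k)) f n))) (sym (rename-∘ _ _ M))))
          (knows M′∈))
    cl-can : cl ⟦ can C ⟧ ≡ cl ⟦ Q ⟧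
    cl-can = trans (cl≡ C) (cong cl (ren-closed ([] ∣ cl ⟦ Q ⟧) (λ { (inj₂ a∈) → small a∈ }) (id-fixes b k)))

  -- Surplus names cannot enter calls: `≲` matches calls literally up to bound names, while known
  -- messages need only be derivable.
  ∈cls-closed : ∀ {T U : Sem S QS} → Closed b U → _≲_ I T U → ∀ {a} → fr a ∈cls cl T → a < b
  ∈cls-closed {T} {U} closed (f , _ , (_ , (cs , cl↭))) {a} a∈ = closed (inj₂ (↭ₚ.Any-resp-↭ (↭-sym cl↭)
    (Anyₚ.++⁺ˡ (subst (_∈cls map (renCall (renBound f)) (cl T)) (renBound-fr f a) (∈cls-ren⁺ (renBound f) a∈)))))

theorem41 : (S QS : Signature) (I : IntruderModel S) (Y : List Name) (s k : ℕ)
    (P : ℕ → Proc S QS) → (∀ i → Depth I Y s k (P i)) →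
    ∃[ i ] ∃[ j ] (i < j) × _⊑_ I (P i) (P j)
theorem41 S QS I Y s k P depth =
  -- The levels are `k` for binders and one more for leaves.
  let i , j , i<j , t≼u = goodPair (af-≼ (suc k)) (forest ∘ C)
  in  i , j , i<j , ≲⇒⊑ I (P i) (P j) (fn<b i) (fn<b j)
        (≲-trans I (proj₂ (Q≋P i)) (≲-canonical I b k s ⟦ P j ⟧ (closed j) (C i) (calls<b i)
          (≲-trans I (proj₁ (≡ₚ-sound I (can≡ (C i)))) (≲-trans I (≼⇒≲ I b k s 0 t≼u)
            (≲-trans I (proj₂ (≡ₚ-sound I (can≡ (C j))))
              (canonical-≲ I b k s ⟦ P j ⟧ (closed j) (C j) (proj₁ (Q≋P j))))))))
  where
  open Canonical
  b = suc (max 0 Y)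
  Q : ℕ → Proc S QS
  Q i = proj₁ (proj₂ (proj₂ (depth i)))
  Q≋P : ∀ i → _≋_ I ⟦ Q i ⟧ ⟦ P i ⟧
  Q≋P i = ≅-sound I (proj₁ (proj₂ (proj₂ (proj₂ (proj₂ (depth i))))))
  fn<b : ∀ i {a} → a ∈fn P i → a < b
  fn<b i a∈ = s≤s (≤max (proj₁ (proj₂ (depth i)) _ a∈))
  closed : ∀ i → Closed b ⟦ P i ⟧
  closed i = fn<b i ∘ fr∈⟦⟧⇒∈fn (P i)
  calls<b : ∀ i {a} → fr a ∈cls cl ⟦ Q i ⟧ → a < b
  calls<b i = ∈cls-closed I b k s (closed i) (proj₁ (Q≋P i))
  C : ∀ i → Canonical I b k s (shift b k) 0 k (Q i)
  C i = let _ , _ , _ , insize , _ , nest≤ = depth i in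
    canonical I b k s (Q i) (shift b k) 0 k refl nest≤ insize (shift-gap b k)
      (λ a∈ → subst (_< b + k) (sym (shift-< b k (calls<b i a∈))) (<-≤-trans (calls<b i a∈) (m≤m+n b k)))
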